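{- Let $s\ge 2r\ge 2$ be integers and put $m=s-2$. For $1\le a\le r-1$ set $b=m-a$, $d=b-a=m-2a$, and define $$\mathcal G_{a,b}(q,t)=\Phi_{a,b}^{d}(t,q)+(t-1)\,\Phi_{a-1,b}^{d+1}(qt,q).$$ Then the $q$-Zeta numerator of the trapezoidal poset $T_{r,s}$ with rank $\rho(i,c)=c-i$ is $$\mathbb{H}_{T_{r,s},\rho}(q,t)=1+\sum_{a=1}^{r-1}\mathcal G_{a,m-a}(q,t).$$ Thus every coefficient of a power of $t$ in $\mathbb{H}_{T_{r,s},\rho}(q,t)$ has an explicit finite Gaussian-binomial expression.
   Context: $q$-Zeta numerator: let $P$ be a finite graded poset with a unique maximum and rank function $\rho:P\to\{0,\dots,H\}$, where $H$ is the maximal rank. For $m\ge 0$ put $A_m(P,\rho;q)=\sum_{x_1\le\cdots\le x_m}q^{\rho(x_1)+\cdots+\rho(x_m)}$ (sum over weak chains in $P$; $A_0=1$). The numerator $\mathbb{H}_{P,\rho}(q,t)$ is the polynomial determined by $\sum_{m\ge 0}A_m(P,\rho;q)t^m=\mathbb{H}_{P,\rho}(q,t)/\prod_{a=0}^{H}(1-q^at)$. Trapezoidal poset: $T_{r,s}=\{(i,c):1\le i\le r,\ i\le c\le s-i\}$, ordered by $(i,c)\le(j,d)\iff i\ge j$ and $c\le d$. Gaussian binomials: for integers $N,k$, $\genfrac{[}{]}{0pt}{}{N}{k}_q=\prod_{u=1}^{k}\frac{1-q^{N-k+u}}{1-q^u}$ if $0\le k\le N$, and $0$ otherwise (including when $N<0$).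 One-boundary polynomial: for integers $a,b,d\ge0$ with $b\le a+d$, $$\Phi_{a,b}^{d}(X,q)=\sum_{\nu\ge0}X^{\nu}q^{\nu^2}\left(\genfrac{[}{]}{0pt}{}{a}{\nu}_q\genfrac{[}{]}{0pt}{}{b}{\nu}_q-q^{d}\genfrac{[}{]}{0pt}{}{b-d+1}{\nu+1}_q\genfrac{[}{]}{0pt}{}{a+d-1}{\nu-1}_q\right).$$ -}

module Defs where

open import Algebra.Bundles.Raw using (RawRing)
import Algebra.Definitions.RawMonoid as RawMonoidDefs
import Algebra.Definitions.RawSemiring as RawSemiringDefs
open import Data.Bool using (if_then_else_)
open import Data.Empty using (⊥-elim)
open import Data.Fin using (Fin; toℕ)
open import Data.Integer as ℤ using (ℤ; +_)
open import Data.List using (List; []; _∷_; map; foldr; filter; mapMaybe; upTo; cartesianProduct; cartesianProductWith)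
open import Data.List.Membership.Propositional using (_∈_)
open import Data.List.Membership.Propositional.Properties using (∈-cartesianProduct⁺; ∈-upTo⁺)
open import Data.List.Relation.Unary.All using (All; []; _∷_)
open import Data.List.Relation.Unary.AllPairs using ([]; _∷_)
open import Data.List.Relation.Unary.Any using (here; there)
open import Data.List.Relation.Unary.Linked using (Linked; linked?)
open import Data.List.Relation.Unary.Unique.Propositional using (Unique)
open import Data.List.Relation.Unary.Unique.Propositional.Properties using (cartesianProduct⁺; upTo⁺)
open import Data.Maybe using (Maybe; just; nothing)
open import Data.Nat as ℕ using (ℕ; zero; suc; _∸_; z≤n; s≤s)
open import Data.Nat.Divisibility using (_∣?_)
open import Data.Nat.ListAction using (sum)
import Data.Nat.Properties as ℕₚ
open import Data.Product using (∃; _×_; _,_)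
open import Data.Sum using (_⊎_; inj₁; inj₂)
open import Level using (Level; 0ℓ)
open import Relation.Binary.Definitions using (Maximum)
open import Relation.Binary.PropositionalEquality using (_≡_; _≢_; refl; sym; trans; cong; subst; isEquivalence)
open import Relation.Binary.Structures using (IsDecPartialOrder)
open import Relation.Nullary using (yes; no; does)
open import Relation.Nullary.Decidable using (_×-dec_; map′)

module Ops {a ℓ : Level} (R : RawRing a ℓ) where
  open RawRing R public
  open RawSemiringDefs rawSemiring public using (_^_)

  infixl 6 _-_
  _-_ : Carrier → Carrier → Carrier
  x - y = x + (- y)

  ∑< ∏< : ℕ → (ℕ → Carrier) → Carrier
  ∑< n f = RawMonoidDefs.sum +-rawMonoid (λ (i : Fin n) → f (toℕ i))
  ∏< n f = RawMonoidDefs.sum *-rawMonoid (λ (i : Fin n) → f (toℕ i))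

  infix 5 ∑< ∏<
  syntax ∑< n (λ i → e) = ∑[ i < n ] e
  syntax ∏< n (λ i → e) = ∏[ i < n ] e

-- A power series is its sequence of coefficients; multiplication is the
-- Cauchy product.
module _ {a ℓ : Level} (R : RawRing a ℓ) where
  private module R = Ops R

  Series : RawRing a ℓ
  Series = record
    { Carrier = ℕ → R.Carrier
    ; _≈_     = λ f g → ∀ n → f n R.≈ g n
    ; _+_     = λ f g n → f n R.+ g n
    ; _*_     = λ f g n → R.∑< (suc n) (λ i → f i R.* g (n ∸ i))
    ; -_      = λ f n → R.- f n
    ; 0#      = λ _ → R.0#
    ; 1#      = λ { zero → R.1# ; (suc _) → R.0# }
    }

  const : R.Carrier → ℕ → R.Carrier
  const x zero    = x
  const x (suc _) = R.0#

  var : ℕ → R.Carrier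
  var zero          = R.0#
  var (suc zero)    = R.1#
  var (suc (suc _)) = R.0#

  -- f(X) ↦ f(zX)
  rescale : R.Carrier → (ℕ → R.Carrier) → (ℕ → R.Carrier)
  rescale z f n = (z R.^ n) R.* f n

ℤ⟦q⟧ : RawRing 0ℓ 0ℓ
ℤ⟦q⟧ = Series ℤ.+-*-rawRing

-- ℤ⟦q⟧⟦t⟧: the first index of a series is the exponent of t, the second
-- the exponent of q.  Polynomials are the series of finite support.
ℤ⟦q⟧⟦t⟧ : RawRing 0ℓ 0ℓ
ℤ⟦q⟧⟦t⟧ = Series ℤ⟦q⟧

module Q = Ops ℤ⟦q⟧
module T = Ops ℤ⟦q⟧⟦t⟧

q : Q.Carrier
q = var ℤ.+-*-rawRing

t : T.Carrier
t = var ℤ⟦q⟧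

C : Q.Carrier → T.Carrier
C = const ℤ⟦q⟧

IsPolynomial : T.Carrier → Set
IsPolynomial h = ∃ λ D → ∀ n k → (D ℕ.≤ n ⊎ D ℕ.≤ k) → h n k ≡ + 0

-- 1/(1 - q^u) = Σ_j q^{uj} in ℤ⟦q⟧, for u ≥ 1
1/[1-q^_] : ℕ → Q.Carrier
1/[1-q^ u ] n = if does (u ∣? n) then + 1 else + 0

-- The quotients are taken in ℤ⟦q⟧; the factor with index j is u = j + 1.
gauss : ℤ → ℤ → Q.Carrier
gauss (+ N) (+ k) =
  if does (k ℕ.≤? N)
  then (∏[ j < k ] ((1# - q ^ (N ∸ k ℕ.+ suc j)) * 1/[1-q^ suc j ]))
  else 0#
  where open Q
gauss _ _ = Q.0#

Φ-coeff : (a b d : ℕ) → ℕ → Q.Carrier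
Φ-coeff a b d ν =
  q ^ (ν ℕ.* ν) *
    (gauss (+ a) (+ ν) * gauss (+ b) (+ ν)
      - q ^ d * gauss (+ b ℤ.- + d ℤ.+ + 1) (+ ν ℤ.+ + 1)
              * gauss (+ a ℤ.+ + d ℤ.- + 1) (+ ν ℤ.- + 1))
  where open Q

-- Φ(X , q) as a series in X; no truncation of the sum over ν is needed.
Φ : (a b d : ℕ) → T.Carrier
Φ a b d ν = Φ-coeff a b d ν

-- a ≥ 1 and a ≤ b are assumed, and d = b - a.
𝒢 : (a b : ℕ) → T.Carrier
𝒢 a b = Φ a b d + (t - 1#) * rescale ℤ⟦q⟧ q (Φ (a ∸ 1) b (suc d))
  where
  open T
  d = b ∸ a

-- The summation index j stands for a = j + 1.
formula : (r s : ℕ) → T.Carrier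
formula r s = 1# + (∑[ j < r ∸ 1 ] 𝒢 (suc j) (m ∸ suc j))
  where
  open T
  m = s ∸ 2

-- The coefficient of t^n in 𝒢 and in 1 + Σ 𝒢, written out.
𝒢-coeff : (a b : ℕ) → ℕ → Q.Carrier
𝒢-coeff a b zero = Φ-coeff a b d 0 - Φ-coeff (a ∸ 1) b (suc d) 0
  where
  open Q
  d = b ∸ a
𝒢-coeff a b (suc n) =
  Φ-coeff a b d (suc n)
    + q ^ n * Φ-coeff (a ∸ 1) b (suc d) n
    - q ^ suc n * Φ-coeff (a ∸ 1) b (suc d) (suc n)
  where
  open Q
  d = b ∸ a

formula-coeff : (r s : ℕ) → ℕ → Q.Carrier
formula-coeff r s n = δ n + (∑[ j < r ∸ 1 ] 𝒢-coeff (suc j) (m ∸ suc j) n)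
  where
  open Q
  m = s ∸ 2
  δ : ℕ → Q.Carrier
  δ zero    = 1#
  δ (suc _) = 0#

record FiniteGradedPoset : Set₁ where
  infix 4 _⊑_ _⋖_
  field
    Carrier           : Set
    _⊑_               : Carrier → Carrier → Set
    isDecPartialOrder : IsDecPartialOrder _≡_ _⊑_

    elements          : List Carrier
    complete          : ∀ x → x ∈ elements
    unique            : Unique elements

    top               : Carrier
    maximum           : Maximum _⊑_ top

  open IsDecPartialOrder isDecPartialOrder public using () renaming (_≤?_ to _⊑?_)

  _⋖_ : Carrier → Carrier → Set
  x ⋖ y = x ⊑ y × x ≢ y × (∀ z → x ⊑ z → z ⊑ y → z ≡ x ⊎ z ≡ y)

  field
    rank        : Carrier → ℕ
    rank-strict : ∀ {x y} → x ⊑ y → x ≢ y → rank x ℕ.< rank y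
    rank-cover  : ∀ {x y} → x ⋖ y → rank y ≡ suc (rank x)

  -- The maximal rank, as rank is monotone.
  height : ℕ
  height = rank top

tuples : {A : Set} → ℕ → List A → List (List A)
tuples zero    xs = [] ∷ []
tuples (suc m) xs = cartesianProductWith _∷_ xs (tuples m xs)

module _ (P : FiniteGradedPoset) where
  open FiniteGradedPoset P

  weakChains : ℕ → List (List Carrier)
  weakChains m = filter (linked? _⊑?_) (tuples m elements)

  -- The coefficient A_m of t^m; the series itself is Σ_m A_m t^m.
  A : T.Carrier
  A m = foldr _+_ 0# (map (λ xs → q ^ sum (map rank xs)) (weakChains m))
    where open Q using (_+_; 0#; _^_)

  denominator : T.Carrier
  denominator = ∏[ a < suc height ] (1# - C (q Q.^ a) * t)
    where open T

  -- The defining equation Σ_m A_m t^m = h / denominator, cleared of the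
  -- denominator, which has constant term 1 and so is a unit of ℤ⟦q⟧⟦t⟧.
  record IsNumerator (h : T.Carrier) : Set where
    field
      polynomial : IsPolynomial h
      equation   : A T.* denominator T.≈ h

record Cell (r s : ℕ) : Set where
  constructor cell
  field
    row col : ℕ
    1≤row   : 1 ℕ.≤ row
    row≤r   : row ℕ.≤ r
    row≤col : row ℕ.≤ col
    col≤    : col ℕ.≤ s ∸ row

module _ {r s : ℕ} where
  open Cell

  infix 4 _≼_
  _≼_ : Cell r s → Cell r s → Set
  x ≼ y = row y ℕ.≤ row x × col x ℕ.≤ col y

  ρ : Cell r s → ℕ
  ρ x = col x ∸ row x

  cell-≡ : {x y : Cell r s} → row x ≡ row y → col x ≡ col y → x ≡ y
  cell-≡ {cell i c p₁ p₂ p₃ p₄} {cell _ _ q₁ q₂ q₃ q₄} refl refl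
    with refl ← ℕₚ.≤-irrelevant p₁ q₁ | refl ← ℕₚ.≤-irrelevant p₂ q₂
       | refl ← ℕₚ.≤-irrelevant p₃ q₃ | refl ← ℕₚ.≤-irrelevant p₄ q₄ = refl

  ≼-isDecPartialOrder : IsDecPartialOrder _≡_ _≼_
  ≼-isDecPartialOrder = record
    { isPartialOrder = record
      { isPreorder = record
        { isEquivalence = isEquivalence
        ; reflexive     = λ { refl → ℕₚ.≤-refl , ℕₚ.≤-refl }
        ; trans         = λ { (p , p′) (q , q′) → ℕₚ.≤-trans q p , ℕₚ.≤-trans p′ q′ }
        }
      ; antisym = λ { (p , p′) (q , q′) → cell-≡ (ℕₚ.≤-antisym q p) (ℕₚ.≤-antisym p′ q′) }
      }
    ; _≟_  = λ x y → map′ (λ { (p , p′) → cell-≡ p p′ }) (λ { refl → refl , refl })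
                          ((row x ℕ.≟ row y) ×-dec (col x ℕ.≟ col y))
    ; _≤?_ = λ x y → (row y ℕ.≤? row x) ×-dec (col x ℕ.≤? col y)
    }

  ρ-strict : {x y : Cell r s} → x ≼ y → x ≢ y → ρ x ℕ.< ρ y
  ρ-strict {x} {y} (p , p′) x≢y with row y ℕ.≟ row x
  ... | no ≢ = ℕₚ.<-≤-trans (ℕₚ.∸-monoʳ-< (ℕₚ.≤∧≢⇒< p ≢) (row≤col x))
                            (ℕₚ.∸-monoˡ-≤ (row y) p′)
  ... | yes e = subst (λ k → col x ∸ row x ℕ.< col y ∸ k) (sym e)
                  (ℕₚ.∸-monoˡ-< (ℕₚ.≤∧≢⇒< p′ (λ e′ → x≢y (cell-≡ (sym e) e′))) (row≤col x))

  ρ-cover : {x y : Cell r s} → x ≼ y × x ≢ y × (∀ z → x ≼ z → z ≼ y → z ≡ x ⊎ z ≡ y) →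
            ρ y ≡ suc (ρ x)
  ρ-cover {x@(cell (suc i) c _ i<r i<c c≤)} {y} ((p , p′) , x≢y , between) with row y ℕ.≟ suc i
  ... | no ≢ = go (between z (ℕₚ.n≤1+n i , ℕₚ.≤-refl) (j≤i , p′))
    where
    j≤i : row y ℕ.≤ i
    j≤i = ℕ.s≤s⁻¹ (ℕₚ.≤∧≢⇒< p ≢)
    z : Cell r s
    z = cell i c (ℕₚ.≤-trans (1≤row y) j≤i) (ℕₚ.<⇒≤ i<r) (ℕₚ.<⇒≤ i<c)
             (ℕₚ.≤-trans c≤ (ℕₚ.∸-monoʳ-≤ s (ℕₚ.n≤1+n i)))
    go : z ≡ x ⊎ z ≡ y → ρ y ≡ suc (c ∸ suc i)
    go (inj₁ e) = ⊥-elim (ℕₚ.1+n≢n (sym (cong row e)))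
    go (inj₂ e) = trans (cong ρ (sym e)) (ℕₚ.+-∸-assoc 1 i<c)
  ... | yes e₀ = go (between z (ℕₚ.≤-refl , ℕₚ.n≤1+n c) (p , c<d))
    where
    c<d : c ℕ.< col y
    c<d = ℕₚ.≤∧≢⇒< p′ (λ e′ → x≢y (cell-≡ (sym e₀) e′))
    z : Cell r s
    z = cell (suc i) (suc c) (s≤s z≤n) i<r (ℕₚ.m≤n⇒m≤1+n i<c)
             (ℕₚ.≤-trans c<d (subst (λ k → col y ℕ.≤ s ∸ k) e₀ (col≤ y)))
    go : z ≡ x ⊎ z ≡ y → ρ y ≡ suc (c ∸ suc i)
    go (inj₁ e) = ⊥-elim (ℕₚ.1+n≢n (cong col e))
    go (inj₂ e) = trans (cong ρ (sym e)) (ℕₚ.+-∸-assoc 1 i<c)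

  toCell : ℕ × ℕ → Maybe (Cell r s)
  toCell (i , c) with 1 ℕ.≤? i | i ℕ.≤? r | i ℕ.≤? c | c ℕ.≤? s ∸ i
  ... | yes p₁ | yes p₂ | yes p₃ | yes p₄ = just (cell i c p₁ p₂ p₃ p₄)
  ... | _      | _      | _      | _      = nothing

  toCell-sound : ∀ p {x} → toCell p ≡ just x → p ≡ (row x , col x)
  toCell-sound (i , c) e with 1 ℕ.≤? i | i ℕ.≤? r | i ℕ.≤? c | c ℕ.≤? s ∸ i
  toCell-sound (i , c) refl | yes _ | yes _ | yes _ | yes _ = refl

  toCell-complete : ∀ x → toCell (row x , col x) ≡ just x
  toCell-complete (cell i c p₁ p₂ p₃ p₄)
    with 1 ℕ.≤? i | i ℕ.≤? r | i ℕ.≤? c | c ℕ.≤? s ∸ i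
  ... | yes _ | yes _ | yes _ | yes _ = cong just (cell-≡ refl refl)
  ... | no ¬p | _     | _     | _     = ⊥-elim (¬p p₁)
  ... | yes _ | no ¬p | _     | _     = ⊥-elim (¬p p₂)
  ... | yes _ | yes _ | no ¬p | _     = ⊥-elim (¬p p₃)
  ... | yes _ | yes _ | yes _ | no ¬p = ⊥-elim (¬p p₄)

  ∈-mapMaybe-toCell : ∀ x ps → (row x , col x) ∈ ps → x ∈ mapMaybe toCell ps
  ∈-mapMaybe-toCell x (_ ∷ ps) (here refl) rewrite toCell-complete x = here refl
  ∈-mapMaybe-toCell x (p ∷ ps) (there m) with toCell p
  ... | just _  = there (∈-mapMaybe-toCell x ps m)
  ... | nothing = ∈-mapMaybe-toCell x ps m

  mapMaybe-toCell-≢ : ∀ y ps → All ((row y , col y) ≢_) ps → All (y ≢_) (mapMaybe toCell ps)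
  mapMaybe-toCell-≢ y []       []       = []
  mapMaybe-toCell-≢ y (p ∷ ps) (≢ ∷ ≢s) with toCell p in eq
  ... | just x  = (λ { refl → ≢ (sym (toCell-sound p eq)) }) ∷ mapMaybe-toCell-≢ y ps ≢s
  ... | nothing = mapMaybe-toCell-≢ y ps ≢s

  mapMaybe-toCell-unique : ∀ ps → Unique ps → Unique (mapMaybe toCell ps)
  mapMaybe-toCell-unique []       []       = []
  mapMaybe-toCell-unique (p ∷ ps) (≢s ∷ u) with toCell p in eq
  ... | just x  = mapMaybe-toCell-≢ x ps (subst (λ k → All (k ≢_) ps) (toCell-sound p eq) ≢s)
                  ∷ mapMaybe-toCell-unique ps u
  ... | nothing = mapMaybe-toCell-unique ps u

cells : (r s : ℕ) → List (Cell r s)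
cells r s = mapMaybe toCell (cartesianProduct (upTo (suc r)) (upTo (suc s)))

trapezoid : (r s : ℕ) → 1 ℕ.≤ r → 2 ℕ.* r ℕ.≤ s → FiniteGradedPoset
trapezoid r s 1≤r 2r≤s = record
  { Carrier           = Cell r s
  ; _⊑_               = _≼_
  ; isDecPartialOrder = ≼-isDecPartialOrder
  ; elements          = cells r s
  ; complete          = λ x → ∈-mapMaybe-toCell x _
      (∈-cartesianProduct⁺ (∈-upTo⁺ (s≤s (row≤r x)))
                           (∈-upTo⁺ (s≤s (ℕₚ.≤-trans (col≤ x) (ℕₚ.m∸n≤m s (row x))))))
  ; unique            = mapMaybe-toCell-unique _ (cartesianProduct⁺ (upTo⁺ (suc r)) (upTo⁺ (suc s)))
  ; top               = cell 1 (s ∸ 1) ℕₚ.≤-refl 1≤r 1≤s∸1 ℕₚ.≤-refl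
  ; maximum           = λ x → 1≤row x , ℕₚ.≤-trans (col≤ x) (ℕₚ.∸-monoʳ-≤ s (1≤row x))
  ; rank              = ρ
  ; rank-strict       = ρ-strict
  ; rank-cover        = ρ-cover
  }
  where
  open Cell
  1≤s∸1 : 1 ℕ.≤ s ∸ 1
  1≤s∸1 = ℕₚ.∸-monoˡ-≤ 1 (ℕₚ.≤-trans (ℕₚ.*-monoʳ-≤ 2 1≤r) 2r≤s)

{-# OPTIONS --safe #-}

-- For a row bound α and a column bound γ let F α γ be the generating series of
-- the weak chains in the quadrant {row ≤ α, γ ≤ col}.  Inclusion–exclusion on
-- the corner cell (α , γ), of rank k = γ − α, gives
--   (1 − q^k t) F(α,γ) = F(α−1,γ) + F(α,γ+1) − F(α−1,γ+1),
-- where the last two terms cancel on the boundary α + γ = s.  After clearing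
-- denominators the q-Pascal rule shows that Φ_{a,b}^{b−a}(q^k t , q), with
-- a = α − 1 and b = s − 1 − γ, satisfies the same recursion.  A chain lies in the
-- quadrant of one of the minimal cells (α , α), and two consecutive such
-- quadrants meet in the quadrant of (α , α + 1); hence A is the alternating sum
-- Σ F(α,α) − Σ F(α,α+1), which is the formula.
module Submission where

open import Defs
open import Algebra.Bundles using (CommutativeRing; Monoid)
import Algebra.Properties.AbelianGroup
import Algebra.Properties.CommutativeSemigroup
import Algebra.Properties.Group
import Algebra.Properties.Monoid.Sum
import Algebra.Properties.Ring
import Algebra.Properties.Semiring.Exp
import Algebra.Properties.Semiring.Mult.TCOptimised
import Algebra.Solver.Ring
open import Algebra.Solver.Ring.AlmostCommutativeRing using (_-Raw-AlmostCommutative⟶_; fromCommutativeRing)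
open import Data.Bool using (true; false; if_then_else_)
open import Data.Empty using (⊥-elim)
open import Data.Fin using (Fin; toℕ)
open import Data.Fin.Properties using (toℕ-fromℕ; toℕ-inject₁; toℕ<n)
open import Data.Integer as ℤ using (ℤ; +_; -[1+_]; _⊖_)
import Data.Integer.Properties as ℤₚ
open import Data.List using (List; []; _∷_; map; foldr; filter; cartesianProductWith; _++_)
open import Data.List.Membership.Propositional using (_∈_)
open import Data.List.Relation.Unary.All using (All; []; _∷_)
open import Data.List.Relation.Unary.AllPairs using ([]; _∷_)
open import Data.List.Relation.Unary.Any using (here; there)
open import Data.List.Relation.Unary.Linked using (linked?)
open import Data.List.Relation.Unary.Unique.Propositional using (Unique)
open import Data.Maybe using (Maybe; just; nothing)
open import Data.Nat as ℕ using (ℕ; zero; suc; _≤_; _<_; _∸_; _⊔_; z≤n; s≤s)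
open import Data.Nat.Divisibility using (_∣_; _∣?_; ∣m+n∣m⇒∣n; ∣m∣n⇒∣m+n; ∣-refl; ∣⇒≤; _∣0)
open import Data.Nat.ListAction using () renaming (sum to ℕ-sum)
import Data.Nat.Properties as ℕₚ
open import Data.Nat.Solver using (module +-*-Solver)
open import Data.Product using (∃; _×_; _,_; proj₁; proj₂)
open import Data.Sign as Sign using (Sign)
open import Data.Sum using (_⊎_; inj₁; inj₂)
open import Function.Bundles using (_⇔_; mk⇔)
open import Relation.Binary.Definitions using (Decidable; DecidableEquality; tri<; tri≈; tri>)
open import Relation.Binary.PropositionalEquality as ≡ using (_≡_; _≢_)
import Relation.Binary.Reasoning.Setoid
open import Relation.Binary.Structures using (IsDecPartialOrder)
open import Relation.Nullary using (Dec; yes; no; does; ¬_)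
open import Relation.Nullary.Decidable using (dec-true; dec-false; _×-dec_)
import Relation.Unary as Unary

-- The four quadrants of the recursion do not share a denominator. A quadrant whose corner has rank
-- k contains exactly the ranks k, ..., s - 2, and its denominator is the product of 1 - q^i t over
-- these i. Dropping one row or one column loses the factor of rank k, dropping both loses two
-- factors. Over the common denominator the numerators therefore satisfy n = n₁ + n₂ - (1 - q^(k+1)
-- t) n₁₂, and this is the identity to be proved for Φ, together with the boundary rule
-- Φ_{a+1,a+1}^0(X) = Φ_{a,a+1}^1(qX) and the initial value Φ_{0,b}^b = 1 on row 1. Recursions are
-- stated without subtraction, so that they can be checked coefficient by coefficient. The
-- combinatorics and the q-identities live over any commutative ring with an element q and inverses
-- of all 1 - q^(j+1). Polynomiality is specific to `ℤ⟦q⟧`: there the Gaussian binomials are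
-- products involving infinite series.

-- Ring solving with integer coefficients over any commutative ring.

module IntegerSolver {c ℓ} (R : CommutativeRing c ℓ) where
  open CommutativeRing R
  open Algebra.Properties.Ring ring using (-0#≈0#; -‿distribˡ-*; -‿distribʳ-*; -‿involutive)
  open Algebra.Properties.AbelianGroup +-abelianGroup using (⁻¹-∙-comm)
  open Algebra.Properties.CommutativeSemigroup +-commutativeSemigroup using (interchange)
  open Algebra.Properties.Semiring.Mult.TCOptimised semiring using (×-homo-+; ×1-homo-*; 1+×) renaming (_×_ to _·_)
  open Relation.Binary.Reasoning.Setoid setoid

  private
    infix 9 _·1
    _·1 : ℕ → Carrier
    n ·1 = n · 1#

    ⟦_⟧ : ℤ → Carrier
    ⟦ + n ⟧      = n ·1
    ⟦ -[1+ n ] ⟧ = - (suc n ·1)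

    ⟦⟧-neg : ∀ i → ⟦ ℤ.- i ⟧ ≈ - ⟦ i ⟧
    ⟦⟧-neg (+ zero)   = sym -0#≈0#
    ⟦⟧-neg (+ suc n)  = refl
    ⟦⟧-neg -[1+ n ]   = sym (-‿involutive _)

    ⟦⟧-⊖ : ∀ m n → ⟦ m ⊖ n ⟧ ≈ m ·1 + - (n ·1)
    ⟦⟧-⊖ m       zero    = sym (trans (+-congˡ -0#≈0#) (+-identityʳ _))
    ⟦⟧-⊖ zero    (suc n) = sym (+-identityˡ _)
    ⟦⟧-⊖ (suc m) (suc n) = begin
      ⟦ suc m ⊖ suc n ⟧                    ≡⟨ ≡.cong ⟦_⟧ (ℤₚ.[1+m]⊖[1+n]≡m⊖n m n) ⟩
      ⟦ m ⊖ n ⟧                            ≈⟨ ⟦⟧-⊖ m n ⟩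
      m ·1 + - (n ·1)                      ≈⟨ +-identityˡ _ ⟨
      0# + (m ·1 + - (n ·1))               ≈⟨ +-congʳ (-‿inverseʳ 1#) ⟨
      (1# + - 1#) + (m ·1 + - (n ·1))      ≈⟨ interchange _ _ _ _ ⟩
      (1# + m ·1) + (- 1# + - (n ·1))
        ≈⟨ +-cong (sym (1+× m 1#)) (trans (⁻¹-∙-comm _ _) (-‿cong (sym (1+× n 1#)))) ⟩
      suc m ·1 + - (suc n ·1)              ∎

    ⟦⟧-+ : ∀ i j → ⟦ i ℤ.+ j ⟧ ≈ ⟦ i ⟧ + ⟦ j ⟧
    ⟦⟧-+ (+ m)    (+ n)    = ×-homo-+ 1# m n
    ⟦⟧-+ (+ m)    -[1+ n ] = ⟦⟧-⊖ m (suc n)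
    ⟦⟧-+ -[1+ m ] (+ n)    = trans (⟦⟧-⊖ n (suc m)) (+-comm _ _)
    ⟦⟧-+ -[1+ m ] -[1+ n ] = begin
      - ((2 ℕ.+ (m ℕ.+ n)) ·1)    ≡⟨ ≡.cong (λ k → - (suc k ·1)) (≡.sym (ℕₚ.+-suc m n)) ⟩
      - ((suc m ℕ.+ suc n) ·1)    ≈⟨ -‿cong (×-homo-+ 1# (suc m) (suc n)) ⟩
      - (suc m ·1 + suc n ·1)     ≈⟨ ⁻¹-∙-comm _ _ ⟨
      - (suc m ·1) + - (suc n ·1) ∎

    ⟦⟧-pos : ∀ n → ⟦ Sign.+ ℤ.◃ n ⟧ ≈ n ·1
    ⟦⟧-pos n = reflexive (≡.cong ⟦_⟧ (ℤₚ.+◃n≡+n n))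

    ⟦⟧-minus : ∀ n → ⟦ Sign.- ℤ.◃ n ⟧ ≈ - (n ·1)
    ⟦⟧-minus n = trans (reflexive (≡.cong ⟦_⟧ (ℤₚ.-◃n≡-n n))) (⟦⟧-neg (+ n))

    ⟦⟧-* : ∀ i j → ⟦ i ℤ.* j ⟧ ≈ ⟦ i ⟧ * ⟦ j ⟧
    ⟦⟧-* (+ m)    (+ n)    = trans (⟦⟧-pos (m ℕ.* n)) (×1-homo-* m n)
    ⟦⟧-* (+ m)    -[1+ n ] = trans (⟦⟧-minus (m ℕ.* suc n)) (trans (-‿cong (×1-homo-* m (suc n))) (-‿distribʳ-* _ _))
    ⟦⟧-* -[1+ m ] (+ n)    = trans (⟦⟧-minus (suc m ℕ.* n)) (trans (-‿cong (×1-homo-* (suc m) n)) (-‿distribˡ-* _ _))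
    ⟦⟧-* -[1+ m ] -[1+ n ] = begin
      ⟦ Sign.+ ℤ.◃ (suc m ℕ.* suc n) ⟧   ≈⟨ trans (⟦⟧-pos (suc m ℕ.* suc n)) (×1-homo-* (suc m) (suc n)) ⟩
      suc m ·1 * suc n ·1                ≈⟨ -‿involutive _ ⟨
      - - (suc m ·1 * suc n ·1)          ≈⟨ -‿cong (-‿distribˡ-* _ _) ⟩
      - (- (suc m ·1) * suc n ·1)        ≈⟨ -‿distribʳ-* _ _ ⟩
      - (suc m ·1) * - (suc n ·1)        ∎

    homomorphism : ℤ.+-*-rawRing -Raw-AlmostCommutative⟶ fromCommutativeRing R
    homomorphism = record
      { ⟦_⟧ = ⟦_⟧ ; +-homo = ⟦⟧-+ ; *-homo = ⟦⟧-* ; -‿homo = ⟦⟧-neg ; 0-homo = refl ; 1-homo = refl }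

    -- Only integer coefficients are ever compared, so the solver also serves power series rings,
    -- whose equality is not decidable.
    equal? : ∀ i j → Maybe (⟦ i ⟧ ≈ ⟦ j ⟧)
    equal? i j with i ℤ.≟ j
    ... | yes i≡j = just (reflexive (≡.cong ⟦_⟧ i≡j))
    ... | no _    = nothing

  open Algebra.Solver.Ring ℤ.+-*-rawRing (fromCommutativeRing R) homomorphism equal? public
    using (solve; _:=_; _:+_; _:*_; _:-_; :-_; con)

-- Iterated sums and the ring of power series.

module _ {c ℓ} (M : Monoid c ℓ) where
  open Monoid M
  open Algebra.Properties.Monoid.Sum M

  sum-last : ∀ n (f : ℕ → Carrier) → sum {suc n} (λ i → f (toℕ i)) ≈ sum {n} (λ i → f (toℕ i)) ∙ f n
  sum-last n f = trans (sum-init-last {n} (λ i → f (toℕ i)))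
    (∙-cong (sum-cong-≋ {n} λ i → reflexive (≡.cong f (toℕ-inject₁ i)))
            (reflexive (≡.cong f (toℕ-fromℕ n))))

module SeriesProperties {c ℓ} (R : CommutativeRing c ℓ) where
  open CommutativeRing R
  open Algebra.Properties.CommutativeSemigroup +-commutativeSemigroup using (interchange)
  open Relation.Binary.Reasoning.Setoid setoid
  private module S = Ops (Series rawRing)

  private
    tail : (ℕ → Carrier) → ℕ → Carrier
    tail f n = f (suc n)

    -- The Cauchy product unfolds by computation along its left factor. This is the unfolding along
    -- the right factor, and commutativity follows by playing the two against each other.
    last : ∀ f g n → (f S.* g) (suc n) ≈ (f S.* tail g) n + f (suc n) * g 0
    last f g zero    = begin
      f 0 * g 1 + (f 1 * g 0 + 0#)   ≈⟨ +-cong (sym (+-identityʳ _)) (+-identityʳ _) ⟩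
      f 0 * g 1 + 0# + f 1 * g 0     ∎
    last f g (suc n) = trans (+-congˡ (last (tail f) g n)) (sym (+-assoc _ _ _))

    cong* : ∀ {f f′ g g′} → f S.≈ f′ → g S.≈ g′ → f S.* g S.≈ f′ S.* g′
    cong* p r zero    = +-congʳ (*-cong (p 0) (r 0))
    cong* p r (suc n) = +-cong (*-cong (p 0) (r (suc n))) (cong* (λ i → p (suc i)) r n)

    comm* : ∀ f g → f S.* g S.≈ g S.* f
    comm* f g zero    = +-congʳ (*-comm _ _)
    comm* f g (suc n) = begin
      f 0 * g (suc n) + (tail f S.* g) n   ≈⟨ +-cong (*-comm _ _) (comm* (tail f) g n) ⟩
      g (suc n) * f 0 + (g S.* tail f) n   ≈⟨ +-comm _ _ ⟩
      (g S.* tail f) n + g (suc n) * f 0   ≈⟨ last g f n ⟨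
      (g S.* f) (suc n)                    ∎

    zeroˡ* : ∀ f → S.0# S.* f S.≈ S.0#
    zeroˡ* f zero    = trans (+-identityʳ _) (zeroˡ _)
    zeroˡ* f (suc n) = trans (+-cong (zeroˡ _) (zeroˡ* f n)) (+-identityˡ _)

    distribʳ* : ∀ f g h → (g S.+ h) S.* f S.≈ (g S.* f) S.+ (h S.* f)
    distribʳ* f g h zero    = begin
      (g 0 + h 0) * f 0 + 0#               ≈⟨ +-identityʳ _ ⟩
      (g 0 + h 0) * f 0                    ≈⟨ distribʳ _ _ _ ⟩
      g 0 * f 0 + h 0 * f 0                ≈⟨ +-cong (+-identityʳ _) (+-identityʳ _) ⟨
      (g 0 * f 0 + 0#) + (h 0 * f 0 + 0#)  ∎
    distribʳ* f g h (suc n) = trans (+-cong (distribʳ _ _ _) (distribʳ* f (tail g) (tail h) n)) (interchange _ _ _ _)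

    scaleˡ : ∀ x g h n → ((λ i → x * g i) S.* h) n ≈ x * (g S.* h) n
    scaleˡ x g h zero    = trans (+-identityʳ _) (trans (*-assoc _ _ _) (*-congˡ (sym (+-identityʳ _))))
    scaleˡ x g h (suc n) = trans (+-cong (*-assoc _ _ _) (scaleˡ x (tail g) h n)) (sym (distribˡ _ _ _))

    assoc* : ∀ f g h → (f S.* g) S.* h S.≈ f S.* (g S.* h)
    assoc* f g h zero    = +-congʳ (begin
      (f 0 * g 0 + 0#) * h 0   ≈⟨ *-congʳ (+-identityʳ _) ⟩
      f 0 * g 0 * h 0          ≈⟨ *-assoc _ _ _ ⟩
      f 0 * (g 0 * h 0)        ≈⟨ *-congˡ (+-identityʳ _) ⟨
      f 0 * (g 0 * h 0 + 0#)   ∎)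
    -- The tail of `f S.* g` is by computation `f 0` times `tail g` plus `tail f S.* g`, so the
    -- induction passes from `f` to `tail f`.
    assoc* f g h (suc n) = begin
      (f 0 * g 0 + 0#) * h (suc n) + (((λ i → f 0 * tail g i) S.+ (tail f S.* g)) S.* h) n
        ≈⟨ +-cong (trans (*-congʳ (+-identityʳ _)) (*-assoc _ _ _)) (distribʳ* h (λ i → f 0 * tail g i) (tail f S.* g) n) ⟩
      f 0 * (g 0 * h (suc n)) + (((λ i → f 0 * tail g i) S.* h) n + ((tail f S.* g) S.* h) n)
        ≈⟨ +-congˡ (+-cong (scaleˡ (f 0) (tail g) h n) (assoc* (tail f) g h n)) ⟩
      f 0 * (g 0 * h (suc n)) + (f 0 * (tail g S.* h) n + (tail f S.* (g S.* h)) n)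
        ≈⟨ +-assoc _ _ _ ⟨
      f 0 * (g 0 * h (suc n)) + f 0 * (tail g S.* h) n + (tail f S.* (g S.* h)) n
        ≈⟨ +-congʳ (distribˡ _ _ _) ⟨
      f 0 * (g S.* h) (suc n) + (tail f S.* (g S.* h)) n ∎

  const-* : ∀ x f n → (const rawRing x S.* f) n ≈ x * f n
  const-* x f zero    = +-identityʳ _
  const-* x f (suc n) = trans (+-congˡ (zeroˡ* f n)) (+-identityʳ _)

  const-1# : S.1# S.≈ const rawRing 1#
  const-1# zero    = refl
  const-1# (suc n) = refl

  private
    identityˡ* : ∀ f → S.1# S.* f S.≈ f
    identityˡ* f n = trans (cong* {g = f} const-1# (λ _ → refl) n) (trans (const-* 1# f n) (*-identityˡ _))

  var-*-zero : ∀ f → (var rawRing S.* f) 0 ≈ 0#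
  var-*-zero f = trans (+-identityʳ _) (zeroˡ _)

  var-*-suc : ∀ f n → (var rawRing S.* f) (suc n) ≈ f n
  var-*-suc f n = begin
    0# * f (suc n) + (tail (var rawRing) S.* f) n
      ≈⟨ +-cong (zeroˡ _) (cong* {g = f} tail-var (λ _ → refl) n) ⟩
    0# + (S.1# S.* f) n                             ≈⟨ +-identityˡ _ ⟩
    (S.1# S.* f) n                                  ≈⟨ identityˡ* f n ⟩
    f n                                             ∎
    where
    tail-var : tail (var rawRing) S.≈ S.1#
    tail-var zero    = refl
    tail-var (suc n) = refl

  series : CommutativeRing c ℓ
  series = record
    { Carrier = S.Carrier ; _≈_ = S._≈_ ; _+_ = S._+_ ; _*_ = S._*_ ; -_ = S.-_ ; 0# = S.0# ; 1# = S.1#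
    ; isCommutativeRing = record
      { isRing = record
        { +-isAbelianGroup = record
          { isGroup = record
            { isMonoid = record
              { isSemigroup = record
                { isMagma = record
                  { isEquivalence = record
                    { refl  = λ _ → refl
                    ; sym   = λ p n → sym (p n)
                    ; trans = λ p r n → trans (p n) (r n)
                    }
                  ; ∙-cong = λ p r n → +-cong (p n) (r n)
                  }
                ; assoc = λ f g h n → +-assoc _ _ _
                }
              ; identity = (λ f n → +-identityˡ _) , (λ f n → +-identityʳ _)
              }
            ; inverse = (λ f n → -‿inverseˡ _) , (λ f n → -‿inverseʳ _)
            ; ⁻¹-cong = λ p n → -‿cong (p n)
            }
          ; comm = λ f g n → +-comm _ _
          }
        ; *-cong = cong*
        ; *-assoc = assoc*
        ; *-identity = identityˡ* , (λ f n → trans (comm* f S.1# n) (identityˡ* f n))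
        ; distrib = (λ f g h n → trans (comm* f (g S.+ h) n) (trans (distribʳ* f g h n) (+-cong (comm* g f n) (comm* h f n))))
                  , distribʳ*
        }
      ; *-comm = comm*
      }
    }

open SeriesProperties using (series)

-- Sums over lists weighted by indicator functions.

module ListSums {c ℓ} (R : CommutativeRing c ℓ) where
  open CommutativeRing R
  open Algebra.Properties.CommutativeSemigroup +-commutativeSemigroup using (interchange)
  open Relation.Binary.Reasoning.Setoid setoid

  Σ[_] : {A : Set} → (A → Carrier) → List A → Carrier
  Σ[ f ] xs = foldr _+_ 0# (map f xs)

  ι : ∀ {p} {P : Set p} → Dec P → Carrier
  ι P? = if does P? then 1# else 0#

  ι-true : ∀ {p} {P : Set p} (P? : Dec P) → P → ι P? ≈ 1#
  ι-true P? p = reflexive (≡.cong (if_then 1# else 0#) (dec-true P? p))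

  ι-false : ∀ {p} {P : Set p} (P? : Dec P) → ¬ P → ι P? ≈ 0#
  ι-false P? ¬p = reflexive (≡.cong (if_then 1# else 0#) (dec-false P? ¬p))

  ι-× : ∀ {p p′} {P : Set p} {P′ : Set p′} (P? : Dec P) (P′? : Dec P′) → ι (P? ×-dec P′?) ≈ ι P? * ι P′?
  ι-× P? P′? with does P? | does P′?
  ... | false | _     = sym (zeroˡ _)
  ... | true  | _     = sym (*-identityˡ _)

  ι-≤-suc : ∀ m n → ι (m ℕ.≤? suc n) ≈ ι (m ℕ.≤? n) + ι (m ℕ.≟ suc n)
  ι-≤-suc m n with m ℕ.≤? n | m ℕ.≟ suc n
  ... | yes m≤n | yes ≡.refl = ⊥-elim (ℕₚ.1+n≰n m≤n)
  ... | yes m≤n | no m≢1+n   = trans (ι-true (m ℕ.≤? suc n) (ℕₚ.m≤n⇒m≤1+n m≤n))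
    (trans (sym (+-identityʳ _)) (sym (+-cong (ι-true (m ℕ.≤? n) m≤n) (ι-false (m ℕ.≟ suc n) m≢1+n))))
  ... | no m≰n  | yes m≡1+n  = trans (ι-true (m ℕ.≤? suc n) (ℕₚ.≤-reflexive m≡1+n))
    (trans (sym (+-identityˡ _)) (sym (+-cong (ι-false (m ℕ.≤? n) m≰n) (ι-true (m ℕ.≟ suc n) m≡1+n))))
  ... | no m≰n  | no m≢1+n   = trans (ι-false (m ℕ.≤? suc n) λ m≤1+n → m≰n (ℕ.s≤s⁻¹ (ℕₚ.≤∧≢⇒< m≤1+n m≢1+n)))
    (trans (sym (+-identityˡ _)) (sym (+-cong (ι-false (m ℕ.≤? n) m≰n) (ι-false (m ℕ.≟ suc n) m≢1+n))))

  ι-suc-≤ : ∀ m n → ι (n ℕ.≤? m) ≈ ι (suc n ℕ.≤? m) + ι (m ℕ.≟ n)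
  ι-suc-≤ m n with suc n ℕ.≤? m | m ℕ.≟ n
  ... | yes n<m | yes ≡.refl = ⊥-elim (ℕₚ.1+n≰n n<m)
  ... | yes n<m | no m≢n     = trans (ι-true (n ℕ.≤? m) (ℕₚ.<⇒≤ n<m))
    (trans (sym (+-identityʳ _)) (sym (+-cong (ι-true (suc n ℕ.≤? m) n<m) (ι-false (m ℕ.≟ n) m≢n))))
  ... | no n≮m  | yes m≡n    = trans (ι-true (n ℕ.≤? m) (ℕₚ.≤-reflexive (≡.sym m≡n)))
    (trans (sym (+-identityˡ _)) (sym (+-cong (ι-false (suc n ℕ.≤? m) n≮m) (ι-true (m ℕ.≟ n) m≡n))))
  ... | no n≮m  | no m≢n     = trans (ι-false (n ℕ.≤? m) λ n≤m → n≮m (ℕₚ.≤∧≢⇒< n≤m λ n≡m → m≢n (≡.sym n≡m)))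
    (trans (sym (+-identityˡ _)) (sym (+-cong (ι-false (suc n ℕ.≤? m) n≮m) (ι-false (m ℕ.≟ n) m≢n))))

  ι-*-cong : ∀ {p} {P : Set p} (P? : Dec P) {x y} → (P → x ≈ y) → ι P? * x ≈ ι P? * y
  ι-*-cong (yes p) x≈y = *-congˡ (x≈y p)
  ι-*-cong (no _)  x≈y = trans (zeroˡ _) (sym (zeroˡ _))

  module _ {A : Set} where
    Σ-cong : ∀ {f g : A → Carrier} → (∀ x → f x ≈ g x) → ∀ xs → Σ[ f ] xs ≈ Σ[ g ] xs
    Σ-cong f≈g []       = refl
    Σ-cong f≈g (x ∷ xs) = +-cong (f≈g x) (Σ-cong f≈g xs)

    Σ-zero : ∀ {f : A → Carrier} → (∀ x → f x ≈ 0#) → ∀ xs → Σ[ f ] xs ≈ 0#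
    Σ-zero f≈0 []       = refl
    Σ-zero f≈0 (x ∷ xs) = trans (+-cong (f≈0 x) (Σ-zero f≈0 xs)) (+-identityˡ _)

    Σ-+ : ∀ (f g : A → Carrier) xs → Σ[ (λ x → f x + g x) ] xs ≈ Σ[ f ] xs + Σ[ g ] xs
    Σ-+ f g []       = sym (+-identityˡ _)
    Σ-+ f g (x ∷ xs) = trans (+-congˡ (Σ-+ f g xs)) (interchange _ _ _ _)

    Σ-*ˡ : ∀ z (f : A → Carrier) xs → Σ[ (λ x → z * f x) ] xs ≈ z * Σ[ f ] xs
    Σ-*ˡ z f []       = sym (zeroʳ z)
    Σ-*ˡ z f (x ∷ xs) = trans (+-congˡ (Σ-*ˡ z f xs)) (sym (distribˡ _ _ _))

    Σ-filter : ∀ {p} {P : Unary.Pred A p} (P? : Unary.Decidable P) (f : A → Carrier) xs →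
               Σ[ f ] (filter P? xs) ≈ Σ[ (λ x → ι (P? x) * f x) ] xs
    Σ-filter P? f []       = refl
    Σ-filter P? f (x ∷ xs) with does (P? x)
    ... | false = trans (sym (+-identityˡ _)) (+-cong (sym (zeroˡ _)) (Σ-filter P? f xs))
    ... | true  = +-cong (sym (*-identityˡ _)) (Σ-filter P? f xs)

    Σ-point : (_≟_ : DecidableEquality A) (f : A → Carrier) {x : A} {xs : List A} →
              Unique xs → x ∈ xs → Σ[ (λ y → ι (y ≟ x) * f y) ] xs ≈ f x
    Σ-point _≟_ f {x} (x≢ ∷ u) (here ≡.refl) =
      trans (+-cong (trans (*-congʳ (ι-true (x ≟ x) ≡.refl)) (*-identityˡ _)) (absent x≢)) (+-identityʳ _)
      where
      absent : ∀ {ys} → All (x ≢_) ys → Σ[ (λ y → ι (y ≟ x) * f y) ] ys ≈ 0#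
      absent []         = refl
      absent (_∷_ {y} x≢y x≢ys) =
        trans (+-cong (trans (*-congʳ (ι-false (y ≟ x) λ y≡x → x≢y (≡.sym y≡x))) (zeroˡ _)) (absent x≢ys))
              (+-identityˡ _)
    Σ-point _≟_ f {x} (_∷_ {y} y≢ u) (there x∈xs) =
      trans (+-cong (trans (*-congʳ (ι-false (y ≟ x) (head≢ y≢ x∈xs))) (zeroˡ _)) (Σ-point _≟_ f u x∈xs))
            (+-identityˡ _)
      where
      head≢ : ∀ {ys} → All (y ≢_) ys → x ∈ ys → y ≢ x
      head≢ (y≢z ∷ _)  (here ≡.refl) = y≢z
      head≢ (_ ∷ y≢zs) (there x∈ys)  = head≢ y≢zs x∈ys

    Σ-tuples : ∀ (f : List A → Carrier) n xs →
               Σ[ f ] (tuples (suc n) xs) ≈ Σ[ (λ y → Σ[ (λ l → f (y ∷ l)) ] (tuples n xs)) ] xs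
    Σ-tuples f n xs = outer xs
      where
      inner : ∀ y ls zs → Σ[ f ] (map (y ∷_) ls ++ zs) ≈ Σ[ (λ l → f (y ∷ l)) ] ls + Σ[ f ] zs
      inner y []       zs = sym (+-identityˡ _)
      inner y (l ∷ ls) zs = trans (+-congˡ (inner y ls zs)) (sym (+-assoc _ _ _))

      outer : ∀ ys → Σ[ f ] (cartesianProductWith _∷_ ys (tuples n xs))
                     ≈ Σ[ (λ y → Σ[ (λ l → f (y ∷ l)) ] (tuples n xs)) ] ys
      outer []       = refl
      outer (y ∷ ys) = trans (inner y (tuples n xs) _) (+-congˡ (outer ys))

-- Weighted sums over weak chains.

-- The weight is any function with the laws of a product rather than the product itself, so that q
-- to the sum of the ranks can be used verbatim.
record IsWeight {c ℓ} (R : CommutativeRing c ℓ) {X : Set} (v : X → CommutativeRing.Carrier R)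
                (w : List X → CommutativeRing.Carrier R) : Set ℓ where
  open CommutativeRing R
  field
    w-[] : w [] ≈ 1#
    w-∷  : ∀ x l → w (x ∷ l) ≈ v x * w l

module ChainSums {c ℓ} (R : CommutativeRing c ℓ) {X : Set} {_⊑_ : X → X → Set} (_⊑?_ : Decidable _⊑_) (xs : List X)
  (v : X → CommutativeRing.Carrier R) (w : List X → CommutativeRing.Carrier R) (isWeight : IsWeight R v w) where
  open CommutativeRing R
  open IsWeight isWeight
  open ListSums R
  open IntegerSolver R
  open Relation.Binary.Reasoning.Setoid setoid

  -- The n-th power of the weighted zeta matrix of the order, applied to the all-ones vector.
  above : ℕ → X → Carrier
  above zero    x = 1#
  above (suc n) x = Σ[ (λ y → ι (x ⊑? y) * (v y * above n y)) ] xs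

  private
    -- The head `x` is only a lower bound and carries no weight. In this form the condition on a
    -- longer list splits into `x ⊑ y` and the same condition with head `y`.
    linked : ∀ n x → Σ[ (λ l → ι (linked? _⊑?_ (x ∷ l)) * w l) ] (tuples n xs) ≈ above n x
    linked zero    x = trans (+-identityʳ _) (trans (*-identityˡ _) w-[])
    linked (suc n) x = trans (Σ-tuples _ n xs) (Σ-cong (λ y → begin
        Σ[ (λ l → ι (linked? _⊑?_ (x ∷ y ∷ l)) * w (y ∷ l)) ] (tuples n xs)
          ≈⟨ Σ-cong (λ l → trans (*-cong (ι-× (x ⊑? y) (linked? _⊑?_ (y ∷ l))) (w-∷ y l))
                             (solve 4 (λ a b c d → (a :* b) :* (c :* d) := (a :* c) :* (b :* d)) refl _ _ _ _))
                    (tuples n xs) ⟩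
        Σ[ (λ l → (ι (x ⊑? y) * v y) * (ι (linked? _⊑?_ (y ∷ l)) * w l)) ] (tuples n xs)
          ≈⟨ Σ-*ˡ _ _ (tuples n xs) ⟩
        (ι (x ⊑? y) * v y) * Σ[ (λ l → ι (linked? _⊑?_ (y ∷ l)) * w l) ] (tuples n xs)
          ≈⟨ *-congˡ (linked n y) ⟩
        (ι (x ⊑? y) * v y) * above n y
          ≈⟨ *-assoc _ _ _ ⟩
        ι (x ⊑? y) * (v y * above n y) ∎) xs)

  chains-zero : Σ[ w ] (filter (linked? _⊑?_) (tuples 0 xs)) ≈ 1#
  chains-zero = trans (+-identityʳ _) w-[]

  chains-suc : ∀ n → Σ[ w ] (filter (linked? _⊑?_) (tuples (suc n) xs)) ≈ Σ[ (λ y → v y * above n y) ] xs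
  chains-suc n = trans (Σ-filter (linked? _⊑?_) w (tuples (suc n) xs))
    (trans (Σ-tuples _ n xs) (Σ-cong (λ y → begin
      Σ[ (λ l → ι (linked? _⊑?_ (y ∷ l)) * w (y ∷ l)) ] (tuples n xs)
        ≈⟨ Σ-cong (λ l → trans (*-congˡ (w-∷ y l)) (solve 3 (λ a b c → a :* (b :* c) := b :* (a :* c)) refl _ _ _)) (tuples n xs) ⟩
      Σ[ (λ l → v y * (ι (linked? _⊑?_ (y ∷ l)) * w l)) ] (tuples n xs)
        ≈⟨ Σ-*ˡ _ _ (tuples n xs) ⟩
      v y * Σ[ (λ l → ι (linked? _⊑?_ (y ∷ l)) * w l) ] (tuples n xs)
        ≈⟨ *-congˡ (linked n y) ⟩
      v y * above n y ∎) xs))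

-- Inclusion-exclusion for quadrants.

-- In the trapezoid x ≼ y iff row y ≤ row x and col x ≤ col y, so the up-set of a cell is a quadrant.
module Quadrants {c ℓ} (R : CommutativeRing c ℓ) {X : Set} (row col : X → ℕ) (xs : List X) where
  open CommutativeRing R
  open ListSums R
  open IntegerSolver R

  quadrant : (X → Carrier) → ℕ → ℕ → Carrier
  quadrant φ α γ = Σ[ (λ y → ι ((row y ℕ.≤? α) ×-dec (γ ℕ.≤? col y)) * φ y) ] xs

  rows : (X → Carrier) → ℕ → Carrier
  rows φ α = Σ[ (λ y → ι (row y ℕ.≤? α) * φ y) ] xs

  point : (X → Carrier) → ℕ → ℕ → Carrier
  point φ α γ = Σ[ (λ y → ι ((row y ℕ.≟ α) ×-dec (col y ℕ.≟ γ)) * φ y) ] xs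

  private
    Σ-split₂ : ∀ {f g h k : X → Carrier} → (∀ y → f y + g y ≈ h y + k y) →
               Σ[ f ] xs + Σ[ g ] xs ≈ Σ[ h ] xs + Σ[ k ] xs
    Σ-split₂ e = trans (sym (Σ-+ _ _ xs)) (trans (Σ-cong e xs) (Σ-+ _ _ xs))

  quadrant-interior : ∀ φ α γ →
    quadrant φ (suc α) γ + quadrant φ α (suc γ)
      ≈ (quadrant φ α γ + quadrant φ (suc α) (suc γ)) + point φ (suc α) γ
  quadrant-interior φ α γ = trans (Σ-split₂ pointwise) (+-congʳ (Σ-+ _ _ xs))
    where
    pointwise : ∀ y →
      ι ((row y ℕ.≤? suc α) ×-dec (γ ℕ.≤? col y)) * φ y + ι ((row y ℕ.≤? α) ×-dec (suc γ ℕ.≤? col y)) * φ y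
        ≈ (ι ((row y ℕ.≤? α) ×-dec (γ ℕ.≤? col y)) * φ y + ι ((row y ℕ.≤? suc α) ×-dec (suc γ ℕ.≤? col y)) * φ y)
          + ι ((row y ℕ.≟ suc α) ×-dec (col y ℕ.≟ γ)) * φ y
    pointwise y = trans
      (+-cong (*-congʳ (trans (ι-× (row y ℕ.≤? suc α) (γ ℕ.≤? col y)) (*-cong (ι-≤-suc (row y) α) (ι-suc-≤ (col y) γ))))
              (*-congʳ (ι-× (row y ℕ.≤? α) (suc γ ℕ.≤? col y))))
      (trans
        -- Here a and a′ are the indicators of row ≤ α and row = α + 1, while b and b′ are those of
        -- col > γ and col = γ. The larger quadrants have indicators with a + a′ or b + b′, and the
        -- corner is a′b′.
        (solve 5 (λ a b a′ b′ f → ((a :+ a′) :* (b :+ b′)) :* f :+ (a :* b) :* f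
                   := ((a :* (b :+ b′)) :* f :+ ((a :+ a′) :* b) :* f) :+ (a′ :* b′) :* f) refl
                 (ι (row y ℕ.≤? α)) (ι (suc γ ℕ.≤? col y)) (ι (row y ℕ.≟ suc α)) (ι (col y ℕ.≟ γ)) (φ y))
        (sym (+-cong (+-cong
          (*-congʳ (trans (ι-× (row y ℕ.≤? α) (γ ℕ.≤? col y)) (*-congˡ (ι-suc-≤ (col y) γ))))
          (*-congʳ (trans (ι-× (row y ℕ.≤? suc α) (suc γ ℕ.≤? col y)) (*-congʳ (ι-≤-suc (row y) α)))))
          (*-congʳ (ι-× (row y ℕ.≟ suc α) (col y ℕ.≟ γ))))))

  -- By the hypothesis, row `suc α` can meet the columns from `γ` on only in column `γ`, so that row
  -- adds nothing but the corner.
  quadrant-boundary : ∀ φ α γ → (∀ y → row y ≡ suc α → col y ≤ γ) →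
    quadrant φ (suc α) γ ≈ quadrant φ α γ + point φ (suc α) γ
  quadrant-boundary φ α γ col≤γ = trans (Σ-cong pointwise xs) (Σ-+ _ _ xs)
    where
    on-row : ∀ y → ι (row y ℕ.≟ suc α) * ι (γ ℕ.≤? col y) ≈ ι (row y ℕ.≟ suc α) * ι (col y ℕ.≟ γ)
    on-row y = ι-*-cong (row y ℕ.≟ suc α) λ e → trans (ι-suc-≤ (col y) γ)
      (trans (+-congʳ (ι-false (suc γ ℕ.≤? col y) (ℕₚ.≤⇒≯ (col≤γ y e)))) (+-identityˡ _))

    pointwise : ∀ y → ι ((row y ℕ.≤? suc α) ×-dec (γ ℕ.≤? col y)) * φ y
      ≈ ι ((row y ℕ.≤? α) ×-dec (γ ℕ.≤? col y)) * φ y + ι ((row y ℕ.≟ suc α) ×-dec (col y ℕ.≟ γ)) * φ y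
    pointwise y = trans
      (*-congʳ (trans (ι-× (row y ℕ.≤? suc α) (γ ℕ.≤? col y)) (trans (*-congʳ (ι-≤-suc (row y) α))
        (trans (distribʳ _ _ _) (+-cong (sym (ι-× (row y ℕ.≤? α) (γ ℕ.≤? col y)))
          (trans (on-row y) (sym (ι-× (row y ℕ.≟ suc α) (col y ℕ.≟ γ)))))))))
      (distribʳ _ _ _)

  quadrant-zero : ∀ φ γ → (∀ y → 1 ≤ row y) → quadrant φ 0 γ ≈ 0#
  quadrant-zero φ γ 1≤row = Σ-zero (λ y → trans
    (*-congʳ (ι-false ((row y ℕ.≤? 0) ×-dec (γ ℕ.≤? col y)) λ p → ℕₚ.1+n≰n (ℕₚ.≤-trans (1≤row y) (proj₁ p))))
    (zeroˡ _)) xs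

  rows-zero : ∀ φ → (∀ y → 1 ≤ row y) → rows φ 0 ≈ 0#
  rows-zero φ 1≤row = Σ-zero (λ y → trans
    (*-congʳ (ι-false (row y ℕ.≤? 0) λ p → ℕₚ.1+n≰n (ℕₚ.≤-trans (1≤row y) p)))
    (zeroˡ _)) xs

  rows-all : ∀ φ r → (∀ y → row y ≤ r) → rows φ r ≈ Σ[ φ ] xs
  rows-all φ r row≤r = Σ-cong (λ y → trans (*-congʳ (ι-true (row y ℕ.≤? r) (row≤r y))) (*-identityˡ _)) xs

  -- Since row ≤ col, all of row `suc α` lies in the columns from `suc α` on. The new quadrant
  -- therefore meets the union of all earlier rows in the single quadrant `(α , suc α)`, which is
  -- why no intersections beyond consecutive ones occur.
  rows-suc : ∀ φ α → (∀ y → row y ≤ col y) →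
    rows φ (suc α) + quadrant φ α (suc α) ≈ rows φ α + quadrant φ (suc α) (suc α)
  rows-suc φ α row≤col = Σ-split₂ pointwise
    where
    on-row : ∀ y → ι (row y ℕ.≟ suc α) * ι (suc α ℕ.≤? col y) ≈ ι (row y ℕ.≟ suc α)
    on-row y = trans (ι-*-cong (row y ℕ.≟ suc α) λ e →
      ι-true (suc α ℕ.≤? col y) (≡.subst (_≤ col y) e (row≤col y))) (*-identityʳ _)

    pointwise : ∀ y → ι (row y ℕ.≤? suc α) * φ y + ι ((row y ℕ.≤? α) ×-dec (suc α ℕ.≤? col y)) * φ y
      ≈ ι (row y ℕ.≤? α) * φ y + ι ((row y ℕ.≤? suc α) ×-dec (suc α ℕ.≤? col y)) * φ y
    pointwise y = trans
      (+-cong (*-congʳ (trans (ι-≤-suc (row y) α) (+-congˡ (sym (on-row y)))))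
              (*-congʳ (ι-× (row y ℕ.≤? α) (suc α ℕ.≤? col y))))
      (trans
        (solve 4 (λ a a′ b f → (a :+ a′ :* b) :* f :+ (a :* b) :* f := a :* f :+ ((a :+ a′) :* b) :* f) refl
          (ι (row y ℕ.≤? α)) (ι (row y ℕ.≟ suc α)) (ι (suc α ℕ.≤? col y)) (φ y))
        (+-congˡ (*-congʳ (sym (trans (ι-× (row y ℕ.≤? suc α) (suc α ℕ.≤? col y)) (*-congʳ (ι-≤-suc (row y) α)))))))

-- Gaussian binomials and the coefficient identities of Φ.

module _ {c ℓ} (R : CommutativeRing c ℓ) where
  open CommutativeRing R
  open Ops rawRing using (_^_; ∏<)

  ∏<-cong : ∀ n {f g} → (∀ i → f i ≈ g i) → ∏< n f ≈ ∏< n g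
  ∏<-cong n f≈g = sum-cong-≋ {n} (λ i → f≈g (toℕ i))
    where open Algebra.Properties.Monoid.Sum *-monoid

  Inverses : Carrier → (ℕ → Carrier) → Set ℓ
  Inverses q inv = ∀ j → (1# - q ^ suc j) * inv j ≈ 1#

module QBinomials {c ℓ} (R : CommutativeRing c ℓ) (q : CommutativeRing.Carrier R) (inv : ℕ → CommutativeRing.Carrier R)
  (inverse : Inverses R q inv) where
  open CommutativeRing R
  open Ops rawRing using (_^_; ∏<)
  open IntegerSolver R
  open Algebra.Properties.Semiring.Exp semiring using (^-homo-*)
  open Relation.Binary.Reasoning.Setoid setoid

  -- Written exactly as `gauss` at natural arguments, so that over `ℤ⟦q⟧` the two agree by
  -- computation.
  binom : ℕ → ℕ → Carrier
  binom n k = if does (k ℕ.≤? n) then ∏< k (λ j → (1# - q ^ (n ∸ k ℕ.+ suc j)) * inv j) else 0#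

  private
    factor : ℕ → ℕ → Carrier
    factor m j = 1# - q ^ (m ℕ.+ suc j)

    -- `∏ m k` is the Gaussian binomial of m + k over k; the index m = n - k avoids truncated
    -- subtraction.
    ∏ num : ℕ → ℕ → Carrier
    ∏ m k = ∏< k (λ j → factor m j * inv j)
    num m k = ∏< k (factor m)

    ∏-* : ∀ n (f g : ℕ → Carrier) → ∏< n (λ j → f j * g j) ≈ ∏< n f * ∏< n g
    ∏-* zero    f g = sym (*-identityˡ _)
    ∏-* (suc n) f g = trans (*-congˡ (∏-* n (λ j → f (suc j)) (λ j → g (suc j))))
      (solve 4 (λ a b c d → (a :* b) :* (c :* d) := (a :* c) :* (b :* d)) refl _ _ _ _)

    num-first : ∀ m k → num m (suc k) ≈ (1# - q ^ suc m) * num (suc m) k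
    num-first m k = *-cong (reflexive (≡.cong (λ i → 1# - q ^ i) (ℕₚ.+-comm m 1)))
      (∏<-cong R k (λ j → reflexive (≡.cong (λ i → 1# - q ^ i) (ℕₚ.+-suc m (suc j)))))

    -- With x = q^(m+1) and y = q^(k+1), the last factor of the numerator is 1 - xy = y(1 - x) + (1
    -- - y). The factor 1 - x completes `num m (suc k)`, and 1 - y cancels against the last inverse.
    ∏-pascal : ∀ m k → ∏ (suc m) (suc k) ≈ q ^ suc k * ∏ m (suc k) + ∏ (suc m) k
    ∏-pascal m k = begin
      ∏ (suc m) (suc k)
        ≈⟨ ∏-* (suc k) (factor (suc m)) inv ⟩
      num (suc m) (suc k) * ∏< (suc k) inv
        ≈⟨ *-cong (trans (sum-last *-monoid k (factor (suc m))) (*-congˡ (+-congˡ (-‿cong (^-homo-* q (suc m) (suc k))))))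
                  (sum-last *-monoid k inv) ⟩
      num (suc m) k * (1# - q ^ suc m * q ^ suc k) * (∏< k inv * inv k)
        ≈⟨ solve 5 (λ p x y j i → p :* (con (+ 1) :- x :* y) :* (j :* i)
             := y :* (((con (+ 1) :- x) :* p) :* (j :* i)) :+ (p :* j) :* ((con (+ 1) :- y) :* i))
             refl (num (suc m) k) (q ^ suc m) (q ^ suc k) (∏< k inv) (inv k) ⟩
      q ^ suc k * ((1# - q ^ suc m) * num (suc m) k * (∏< k inv * inv k))
        + (num (suc m) k * ∏< k inv) * ((1# - q ^ suc k) * inv k)
        ≈⟨ +-cong (*-congˡ (sym (trans (∏-* (suc k) (factor m) inv) (*-cong (num-first m k) (sum-last *-monoid k inv)))))
                  (trans (*-cong (sym (∏-* k (factor (suc m)) inv)) (inverse k)) (*-identityʳ _)) ⟩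
      q ^ suc k * ∏ m (suc k) + ∏ (suc m) k ∎

    binom-≤ : ∀ {n k} → k ≤ n → binom n k ≈ ∏ (n ∸ k) k
    binom-≤ {n} {k} k≤n = reflexive (≡.cong (if_then ∏ (n ∸ k) k else 0#) (dec-true (k ℕ.≤? n) k≤n))

  binom-> : ∀ {n k} → n < k → binom n k ≈ 0#
  binom-> {n} {k} n<k =
    reflexive (≡.cong (if_then ∏ (n ∸ k) k else 0#) (dec-false (k ℕ.≤? n) (ℕₚ.<⇒≱ n<k)))

  private
    binom-full : ∀ n → binom n n ≈ 1#
    binom-full n = trans (binom-≤ {n} {n} ℕₚ.≤-refl)
      (trans (reflexive (≡.cong (λ m → ∏ m n) (ℕₚ.n∸n≡0 n)))
             (trans (∏<-cong R n inverse) (ones n)))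
      where
      ones : ∀ n → ∏< n (λ _ → 1#) ≈ 1#
      ones zero    = refl
      ones (suc n) = trans (*-identityˡ _) (ones n)

  pascal : ∀ n k → binom (suc n) (suc k) ≈ q ^ suc k * binom n (suc k) + binom n k
  pascal n k with ℕₚ.<-cmp k n
  ... | tri< k<n _ _ = begin
    binom (suc n) (suc k)                             ≈⟨ binom-≤ {suc n} {suc k} (s≤s (ℕₚ.<⇒≤ k<n)) ⟩
    ∏ (n ∸ k) (suc k)                                 ≡⟨ ≡.cong (λ m → ∏ m (suc k)) n∸k ⟩
    ∏ (suc (n ∸ suc k)) (suc k)                       ≈⟨ ∏-pascal (n ∸ suc k) k ⟩
    q ^ suc k * ∏ (n ∸ suc k) (suc k) + ∏ (suc (n ∸ suc k)) k
      ≈⟨ +-cong (*-congˡ (sym (binom-≤ {n} {suc k} k<n)))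
                (trans (reflexive (≡.cong (λ m → ∏ m k) (≡.sym n∸k))) (sym (binom-≤ {n} {k} (ℕₚ.<⇒≤ k<n)))) ⟩
    q ^ suc k * binom n (suc k) + binom n k           ∎
    where
    n∸k : n ∸ k ≡ suc (n ∸ suc k)
    n∸k = ℕₚ.+-∸-assoc 1 k<n
  ... | tri≈ _ ≡.refl _ = begin
    binom (suc n) (suc n)                    ≈⟨ binom-full (suc n) ⟩
    1#                                       ≈⟨ +-identityˡ _ ⟨
    0# + 1#
      ≈⟨ +-cong (trans (*-congˡ (binom-> {n} {suc n} ℕₚ.≤-refl)) (zeroʳ _)) (binom-full n) ⟨
    q ^ suc n * binom n (suc n) + binom n n  ∎
  ... | tri> _ _ n<k = begin
    binom (suc n) (suc k)                    ≈⟨ binom-> {suc n} {suc k} (s≤s n<k) ⟩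
    0#                                       ≈⟨ +-identityˡ _ ⟨
    0# + 0#
      ≈⟨ +-cong (trans (*-congˡ (binom-> {n} {suc k} (ℕₚ.m≤n⇒m≤1+n n<k))) (zeroʳ _)) (binom-> {n} {k} n<k) ⟨
    q ^ suc k * binom n (suc k) + binom n k  ∎

  -- The lower index k - 1, with the value 0 that `gauss` takes at -1. The q-Pascal rule then holds
  -- at k = 0 as well.
  binom⁻ : ℕ → ℕ → Carrier
  binom⁻ n zero    = 0#
  binom⁻ n (suc k) = binom n k

  pascal⁻ : ∀ n k → binom (suc n) k ≈ q ^ k * binom n k + binom⁻ n k
  pascal⁻ n zero    = sym (trans (+-identityʳ _) (*-identityˡ _))
  pascal⁻ n (suc k) = pascal n k

  -- The coefficient of X^ν in Φ_{a,b}^d, for b = a + d.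
  φ : (a b d ν : ℕ) → Carrier
  φ a b d ν = q ^ (ν ℕ.* ν) * (binom a ν * binom b ν - q ^ d * binom (suc a) (suc ν) * binom⁻ (b ∸ 1) ν)

  φ-zero : ∀ a b d → φ a b d 0 ≈ 1#
  φ-zero a b d = solve 1 (λ x → con (+ 1) :* (con (+ 1) :* con (+ 1) :- x :* con (+ 0)) := con (+ 1)) refl
                   (q ^ d * binom (suc a) 1)

  φ₀-suc : ∀ b d ν → φ 0 b d (suc ν) ≈ 0#
  φ₀-suc b d ν = solve 4 (λ x y z u → x :* (con (+ 0) :* y :- z :* con (+ 0) :* u) := con (+ 0)) refl
    (q ^ (suc ν ℕ.* suc ν)) (binom b (suc ν)) (q ^ d) (binom (b ∸ 1) ν)

  -- One use of q-Pascal in each of the two terms produces the same product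
  -- `binom⁻ a ν * binom (suc a) ν`, which cancels.
  φ-boundary : ∀ a ν → φ (suc a) (suc a) 0 ν ≈ q ^ ν * φ a (suc a) 1 ν
  φ-boundary a ν = begin
    Q * (binom (suc a) ν * binom (suc a) ν - 1# * binom (suc (suc a)) (suc ν) * binom⁻ a ν)
      ≈⟨ *-congˡ (+-cong (*-congʳ (pascal⁻ a ν)) (-‿cong (*-congʳ (*-congˡ (pascal (suc a) ν))))) ⟩
    Q * ((q ^ ν * binom a ν + binom⁻ a ν) * binom (suc a) ν
          - 1# * (q * q ^ ν * binom (suc a) (suc ν) + binom (suc a) ν) * binom⁻ a ν)
      ≈⟨ solve 7 (λ Q M q x x′ y z → Q :* ((M :* x :+ x′) :* y :- con (+ 1) :* (q :* M :* z :+ y) :* x′)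
           := M :* (Q :* (x :* y :- q :* con (+ 1) :* z :* x′))) refl
           Q (q ^ ν) q (binom a ν) (binom⁻ a ν) (binom (suc a) ν) (binom (suc a) (suc ν)) ⟩
    q ^ ν * (Q * (binom a ν * binom (suc a) ν - q * 1# * binom (suc a) (suc ν) * binom⁻ a ν)) ∎
    where Q = q ^ (ν ℕ.* ν)

  q^[suc*suc] : ∀ μ → q ^ (suc μ ℕ.* suc μ) ≈ q * (q ^ μ * (q ^ μ * q ^ (μ ℕ.* μ)))
  q^[suc*suc] μ = *-congˡ (trans (^-homo-* q μ (μ ℕ.* suc μ))
    (*-congˡ (trans (reflexive (≡.cong (q ^_) (ℕₚ.*-suc μ μ))) (^-homo-* q μ (μ ℕ.* μ)))))

  -- This is the numerator recursion at t^ν with the common power q^(kν) removed; the last term sits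
  -- at μ = ν - 1 because its series is multiplied by t.
  φ-interior : ∀ a b d μ → let ν = suc μ in
    φ (suc a) (suc (suc b)) (suc d) ν + q ^ ν * q ^ ν * φ a (suc b) (suc d) ν
      ≈ q ^ ν * (φ a (suc (suc b)) (suc (suc d)) ν + φ (suc a) (suc b) d ν)
        + q * (q ^ μ * q ^ μ) * φ a (suc b) (suc d) μ
  φ-interior a b d μ = begin
    Q * (binom (suc a) ν * binom (suc (suc b)) ν - q * D * binom (suc (suc a)) (suc ν) * binom (suc b) μ)
      + (q * M) * (q * M) * (Q * (binom a ν * binom (suc b) ν - q * D * binom (suc a) (suc ν) * binom b μ))
      ≈⟨ +-cong (*-cong Q≈ (+-cong (*-cong a₁≈ b₁≈) (-‿cong (*-cong (*-congˡ a₂≈) b₂≈)))) (*-congˡ (*-congʳ Q≈)) ⟩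
    _
      -- After q-Pascal has reduced every binomial to six of them, those six are independent
      -- variables of a polynomial identity in q, q^μ, q^(μ²) and q^d.
      ≈⟨ solve 10 (λ q M K D x x′ y′ z u u′ →
            let Q = q :* (M :* (M :* K))
                a₁ = q :* M :* x :+ x′
                y = M :* u :+ u′
                b₁ = q :* M :* y′ :+ y
                a₂ = q :* (q :* M) :* z :+ a₁
            in Q :* (a₁ :* b₁ :- q :* D :* a₂ :* y) :+ (q :* M) :* (q :* M) :* (Q :* (x :* y′ :- q :* D :* z :* u))
            := (q :* M) :* (Q :* (x :* b₁ :- q :* (q :* D) :* z :* y) :+ Q :* (a₁ :* y′ :- D :* a₂ :* u))
               :+ q :* (M :* M) :* (K :* (x′ :* y :- q :* D :* a₁ :* u′)))
           refl q M (q ^ (μ ℕ.* μ)) D (binom a ν) (binom a μ) (binom (suc b) ν) (binom (suc a) (suc ν))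
           (binom b μ) (binom⁻ b μ) ⟩
    _
      ≈⟨ +-cong (*-congˡ (+-cong (*-cong Q≈ (+-cong (*-congˡ b₁≈) (-‿cong (*-congˡ b₂≈))))
                                 (*-cong Q≈ (+-cong (*-congʳ a₁≈) (-‿cong (*-congʳ (*-congˡ a₂≈)))))))
                (*-congˡ (*-congˡ (+-cong (*-congˡ b₂≈) (-‿cong (*-congʳ (*-congˡ a₁≈)))))) ⟨
    (q * M) * (Q * (binom a ν * binom (suc (suc b)) ν - q * (q * D) * binom (suc a) (suc ν) * binom (suc b) μ)
            + Q * (binom (suc a) ν * binom (suc b) ν - D * binom (suc (suc a)) (suc ν) * binom b μ))
      + q * (M * M) * (q ^ (μ ℕ.* μ) * (binom a μ * binom (suc b) μ - q * D * binom (suc a) ν * binom⁻ b μ)) ∎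
    where
    ν = suc μ
    M = q ^ μ
    D = q ^ d
    Q = q ^ (ν ℕ.* ν)
    Q≈  = q^[suc*suc] μ
    a₁≈ = pascal a μ
    b₂≈ = pascal⁻ b μ
    b₁≈ = trans (pascal (suc b) μ) (+-congˡ b₂≈)
    a₂≈ = trans (pascal (suc a) ν) (+-congˡ a₁≈)

-- Clearing denominators in the recursions.

module Elimination {c ℓ} (R : CommutativeRing c ℓ) where
  open CommutativeRing R hiding (_-_)
  open Ops rawRing using (_-_)
  open IntegerSolver R
  open Relation.Binary.Reasoning.Setoid setoid

  private
    isolate : ∀ {x y u c} → x + y ≈ u + c * x → (1# - c) * x ≈ u - y
    isolate {x} {y} {u} {c} e = begin
      (1# - c) * x
        ≈⟨ solve 3 (λ x y c → (con (+ 1) :- c) :* x := (x :+ y) :- c :* x :- y) refl x y c ⟩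
      (x + y) - c * x - y     ≈⟨ +-congʳ (+-congʳ e) ⟩
      (u + c * x) - c * x - y ≈⟨ solve 4 (λ x y c u → (u :+ c :* x) :- c :* x :- y := u :- y) refl x y c u ⟩
      u - y                   ∎

  boundary-step : ∀ {x x₁ c E E′ n} → x ≈ x₁ + c * x → E ≈ (1# - c) * E′ → x₁ * E′ ≈ n → x * E ≈ n
  boundary-step {x} {x₁} {c} {E} {E′} {n} rec E≈ e₁ = begin
    x * E                  ≈⟨ *-congˡ E≈ ⟩
    x * ((1# - c) * E′)
      ≈⟨ solve 3 (λ x c E → x :* ((con (+ 1) :- c) :* E) := ((con (+ 1) :- c) :* x) :* E) refl x c E′ ⟩
    ((1# - c) * x) * E′    ≈⟨ *-congʳ (isolate {y = 0#} (trans (+-identityʳ _) rec)) ⟩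
    (x₁ - 0#) * E′         ≈⟨ solve 2 (λ x E → (x :- con (+ 0)) :* E := x :* E) refl x₁ E′ ⟩
    x₁ * E′                ≈⟨ e₁ ⟩
    n                      ∎

  -- For row 1: the quadrants of `x₁` and `x₁₂` contain no rows, so their series agree and cancel.
  edge-step : ∀ {x x₁ x₂ x₁₂ c E E′ n} → x + x₁₂ ≈ (x₁ + x₂) + c * x → x₁ ≈ x₁₂ →
    E ≈ (1# - c) * E′ → x₂ * E′ ≈ n → x * E ≈ n
  edge-step {x} {x₁} {x₂} {x₁₂} {c} {E} {E′} {n} rec x₁≈x₁₂ E≈ e₂ = boundary-step
    (begin
      x                        ≈⟨ solve 2 (λ x y → x := (x :+ y) :- y) refl x x₁₂ ⟩
      (x + x₁₂) - x₁₂          ≈⟨ +-congʳ (trans rec (+-congʳ (+-congʳ x₁≈x₁₂))) ⟩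
      x₁₂ + x₂ + c * x - x₁₂   ≈⟨ solve 3 (λ y z w → y :+ z :+ w :- y := z :+ w) refl x₁₂ x₂ (c * x) ⟩
      x₂ + c * x               ∎)
    E≈ e₂

  -- Index 1 drops a row, 2 drops a column, 12 drops both. Passing from `E″` to `E′` costs the
  -- factor 1 - `c′`, which is the source of the term `c′ * n₁₂` in the recursion of the numerators.
  interior-step : ∀ {x x₁ x₂ x₁₂ c c′ E E′ E″ n n₁ n₂ n₁₂} →
    x + x₁₂ ≈ (x₁ + x₂) + c * x → n + n₁₂ ≈ (n₁ + n₂) + c′ * n₁₂ →
    E ≈ (1# - c) * E′ → E′ ≈ (1# - c′) * E″ →
    x₁ * E′ ≈ n₁ → x₂ * E′ ≈ n₂ → x₁₂ * E″ ≈ n₁₂ → x * E ≈ n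
  interior-step {x} {x₁} {x₂} {x₁₂} {c} {c′} {E} {E′} {E″} {n} {n₁} {n₂} {n₁₂} recx recn E≈ E′≈ e₁ e₂ e₁₂ = begin
    x * E                                       ≈⟨ *-congˡ E≈ ⟩
    x * ((1# - c) * E′)
      ≈⟨ solve 3 (λ x c E → x :* ((con (+ 1) :- c) :* E) := ((con (+ 1) :- c) :* x) :* E) refl x c E′ ⟩
    ((1# - c) * x) * E′                         ≈⟨ *-congʳ (isolate recx) ⟩
    (x₁ + x₂ - x₁₂) * E′
      ≈⟨ solve 4 (λ a b d E → (a :+ b :- d) :* E := a :* E :+ b :* E :- d :* E) refl x₁ x₂ x₁₂ E′ ⟩
    x₁ * E′ + x₂ * E′ - x₁₂ * E′                ≈⟨ +-cong (+-cong e₁ e₂) (-‿cong (*-congˡ E′≈)) ⟩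
    n₁ + n₂ - x₁₂ * ((1# - c′) * E″)
      ≈⟨ solve 4 (λ u d c E → u :- d :* ((con (+ 1) :- c) :* E) := u :- (con (+ 1) :- c) :* (d :* E)) refl (n₁ + n₂) x₁₂ c′ E″ ⟩
    n₁ + n₂ - (1# - c′) * (x₁₂ * E″)            ≈⟨ +-congˡ (-‿cong (*-congˡ e₁₂)) ⟩
    n₁ + n₂ - (1# - c′) * n₁₂
      ≈⟨ solve 3 (λ u d c → u :- (con (+ 1) :- c) :* d := (u :+ c :* d) :- d) refl (n₁ + n₂) n₁₂ c′ ⟩
    (n₁ + n₂ + c′ * n₁₂) - n₁₂                  ≈⟨ +-congʳ recn ⟨
    (n + n₁₂) - n₁₂                             ≈⟨ solve 2 (λ x y → (x :+ y) :- y := x) refl n n₁₂ ⟩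
    n                                           ∎

  -- The origin of the factor t - 1 in `𝒢`: the overlap `x₋` has no cell of rank 0, so its
  -- denominator `E′` lacks the factor 1 - `c`, where `c` will be t, and `x₋` enters with a minus
  -- sign.
  row-step : ∀ {b b′ x₊ x₋ c E E′ n n₊ n₋} → b′ + x₋ ≈ b + x₊ → b * E ≈ n → x₊ * E ≈ n₊ →
    E ≈ (1# - c) * E′ → x₋ * E′ ≈ n₋ → b′ * E ≈ n + (n₊ + (c - 1#) * n₋)
  row-step {b} {b′} {x₊} {x₋} {c} {E} {E′} {n} {n₊} {n₋} rec e e₊ E≈ e₋ = begin
    b′ * E
      ≈⟨ solve 3 (λ b x E → b :* E := (b :+ x) :* E :- x :* E) refl b′ x₋ E ⟩
    (b′ + x₋) * E - x₋ * E                ≈⟨ +-cong (*-congʳ rec) (-‿cong (*-congˡ E≈)) ⟩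
    (b + x₊) * E - x₋ * ((1# - c) * E′)
      ≈⟨ solve 6 (λ b p m c E E′ → (b :+ p) :* E :- m :* ((con (+ 1) :- c) :* E′)
          := b :* E :+ (p :* E :+ (c :- con (+ 1)) :* (m :* E′))) refl b x₊ x₋ c E E′ ⟩
    b * E + (x₊ * E + (c - 1#) * (x₋ * E′)) ≈⟨ +-cong e (+-cong e₊ (*-congˡ e₋)) ⟩
    n + (n₊ + (c - 1#) * n₋)              ∎

-- Generating series of chains in quadrants.

module Monomials {c ℓ} (R : CommutativeRing c ℓ) where
  open CommutativeRing R
  open SeriesProperties R using (const-*; var-*-zero; var-*-suc)
  private module S = Ops (Series rawRing)

  monomial-zero : ∀ z f → ((const rawRing z S.* var rawRing) S.* f) 0 ≈ 0#
  monomial-zero z f = trans (CommutativeRing.*-assoc (series R) (const rawRing z) (var rawRing) f 0)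
    (trans (const-* z (var rawRing S.* f) 0) (trans (*-congˡ (var-*-zero f)) (zeroʳ _)))

  monomial-suc : ∀ z f n → ((const rawRing z S.* var rawRing) S.* f) (suc n) ≈ z * f n
  monomial-suc z f n = trans (CommutativeRing.*-assoc (series R) (const rawRing z) (var rawRing) f (suc n))
    (trans (const-* z (var rawRing S.* f) (suc n)) (*-congˡ (var-*-suc f n)))

module QuadrantSeries {c ℓ} (R : CommutativeRing c ℓ) {X : Set} (row col : X → ℕ) (xs : List X)
  (v : X → CommutativeRing.Carrier R)
  (point≈ : ∀ φ x → CommutativeRing._≈_ R (Quadrants.point R row col xs φ (row x) (col x)) (φ x)) where
  open CommutativeRing R
  open Quadrants R row col xs
  open ListSums R
  private module S = Ops (Series rawRing)
  open Monomials R

  -- Quadrants are up-sets, so only the first element of a chain has to be constrained.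
  F : ℕ → ℕ → S.Carrier
  F α γ zero    = 1#
  F α γ (suc n) = quadrant (λ y → v y * F (row y) (col y) n) α γ

  F-rows : ℕ → S.Carrier
  F-rows α zero    = 1#
  F-rows α (suc n) = rows (λ y → v y * F (row y) (col y) n) α

  private
    weight : ℕ → X → Carrier
    weight n y = v y * F (row y) (col y) n

    -- Chains are weak: after the corner `x` the chain may continue anywhere in the quadrant of `x`,
    -- including `x` itself. Removing the first element leaves the same series, multiplied by `v x`
    -- and t.
    point-monomial : ∀ n x → point (weight n) (row x) (col x)
                     ≈ ((const rawRing (v x) S.* var rawRing) S.* F (row x) (col x)) (suc n)
    point-monomial n x = trans (point≈ (weight n) x) (sym (monomial-suc (v x) (F (row x) (col x)) n))

  F-interior : ∀ x {α γ} → row x ≡ suc α → col x ≡ γ →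
    F (suc α) γ S.+ F α (suc γ) S.≈ (F α γ S.+ F (suc α) (suc γ))
      S.+ ((const rawRing (v x) S.* var rawRing) S.* F (suc α) γ)
  F-interior x {α} {γ} e ≡.refl zero    = sym (trans (+-congˡ (monomial-zero (v x) (F (suc α) γ))) (+-identityʳ _))
  F-interior x {α} {γ} e ≡.refl (suc n) = trans (quadrant-interior (weight n) α γ)
    (+-congˡ (≡.subst (λ ρ → point (weight n) ρ γ ≈ ((const rawRing (v x) S.* var rawRing) S.* F ρ γ) (suc n))
      e (point-monomial n x)))

  F-boundary : ∀ x {α γ} → row x ≡ suc α → col x ≡ γ → (∀ y → row y ≡ suc α → col y ≤ γ) →
    F (suc α) γ S.≈ F α γ S.+ ((const rawRing (v x) S.* var rawRing) S.* F (suc α) γ)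
  F-boundary x {α} {γ} e ≡.refl col≤γ zero    = sym (trans (+-congˡ (monomial-zero (v x) (F (suc α) γ))) (+-identityʳ _))
  F-boundary x {α} {γ} e ≡.refl col≤γ (suc n) = trans (quadrant-boundary (weight n) α γ col≤γ)
    (+-congˡ (≡.subst (λ ρ → point (weight n) ρ γ ≈ ((const rawRing (v x) S.* var rawRing) S.* F ρ γ) (suc n))
      e (point-monomial n x)))

  F-zero : (∀ y → 1 ≤ row y) → ∀ γ → F 0 γ S.≈ S.1#
  F-zero 1≤row γ zero    = refl
  F-zero 1≤row γ (suc n) = quadrant-zero (weight n) γ 1≤row

  F-rows-zero : (∀ y → 1 ≤ row y) → F-rows 0 S.≈ S.1#
  F-rows-zero 1≤row zero    = refl
  F-rows-zero 1≤row (suc n) = rows-zero (weight n) 1≤row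

  F-rows-suc : (∀ y → row y ≤ col y) → ∀ α →
    F-rows (suc α) S.+ F α (suc α) S.≈ F-rows α S.+ F (suc α) (suc α)
  F-rows-suc row≤col α zero    = refl
  F-rows-suc row≤col α (suc n) = rows-suc (weight n) α row≤col

-- The recursion for the numerators.

module NumeratorSeries {c ℓ} (R : CommutativeRing c ℓ) (q : CommutativeRing.Carrier R) (inv : ℕ → CommutativeRing.Carrier R)
  (inverse : Inverses R q inv) where
  open CommutativeRing R
  open Ops rawRing using (_^_)
  open QBinomials R q inv inverse
  open IntegerSolver R
  open Algebra.Properties.Semiring.Exp semiring using (^-homo-*)
  open Relation.Binary.Reasoning.Setoid setoid
  private module S = Ops (Series rawRing)
  open Monomials R

  -- Φ_{a,b}^d(q^k t , q)
  N : (k a b d : ℕ) → S.Carrier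
  N k a b d ν = q ^ (k ℕ.* ν) * φ a b d ν

  monomial : ℕ → S.Carrier
  monomial k = const rawRing (q ^ k) S.* var rawRing

  private
    q^[k*0] : ∀ k → q ^ (k ℕ.* 0) ≈ 1#
    q^[k*0] k = reflexive (≡.cong (q ^_) (ℕₚ.*-zeroʳ k))

  N-zero : ∀ k a b d → N k a b d 0 ≈ 1#
  N-zero k a b d = trans (*-cong (q^[k*0] k) (φ-zero a b d)) (*-identityˡ _)

  N₀ : ∀ k b d → N k 0 b d S.≈ S.1#
  N₀ k b d zero    = N-zero k 0 b d
  N₀ k b d (suc ν) = trans (*-congˡ (φ₀-suc b d ν)) (zeroʳ _)

  N-boundary : ∀ k a → N k (suc a) (suc a) 0 S.≈ N (suc k) a (suc a) 1
  N-boundary k a ν = begin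
    q ^ (k ℕ.* ν) * φ (suc a) (suc a) 0 ν            ≈⟨ *-congˡ (φ-boundary a ν) ⟩
    q ^ (k ℕ.* ν) * (q ^ ν * φ a (suc a) 1 ν)
      ≈⟨ solve 3 (λ x y z → x :* (y :* z) := (y :* x) :* z) refl _ _ _ ⟩
    q ^ ν * q ^ (k ℕ.* ν) * φ a (suc a) 1 ν          ≈⟨ *-congʳ (^-homo-* q ν (k ℕ.* ν)) ⟨
    q ^ (ν ℕ.+ k ℕ.* ν) * φ a (suc a) 1 ν            ∎

  N-interior : ∀ k a b d →
    N k (suc a) (suc (suc b)) (suc d) S.+ N (suc (suc k)) a (suc b) (suc d)
      S.≈ (N (suc k) a (suc (suc b)) (suc (suc d)) S.+ N (suc k) (suc a) (suc b) d)
          S.+ (monomial (suc k) S.* N (suc (suc k)) a (suc b) (suc d))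
  N-interior k a b d zero = begin
    N k (suc a) (suc (suc b)) (suc d) 0 + N (suc (suc k)) a (suc b) (suc d) 0
      ≈⟨ +-cong (N-zero k (suc a) (suc (suc b)) (suc d)) (N-zero (suc (suc k)) a (suc b) (suc d)) ⟩
    1# + 1#
      ≈⟨ +-identityʳ _ ⟨
    1# + 1# + 0#
      ≈⟨ +-cong (+-cong (N-zero (suc k) a (suc (suc b)) (suc (suc d))) (N-zero (suc k) (suc a) (suc b) d))
                (monomial-zero (q ^ suc k) n) ⟨
    _ ∎
    where n = N (suc (suc k)) a (suc b) (suc d)
  N-interior k a b d (suc μ) = begin
    K * f + q ^ (suc (suc k) ℕ.* ν) * f₁₂
      ≈⟨ +-congˡ (*-congʳ (trans (^-homo-* q ν (suc k ℕ.* ν)) (*-congˡ (^-homo-* q ν (k ℕ.* ν))))) ⟩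
    K * f + V * (V * K) * f₁₂
      ≈⟨ solve 4 (λ K V f g → K :* f :+ V :* (V :* K) :* g := K :* (f :+ V :* V :* g)) refl K V f f₁₂ ⟩
    K * (f + V * V * f₁₂)
      ≈⟨ *-congˡ (φ-interior a b d μ) ⟩
    K * (V * (f₁ + f₂) + q * (M * M) * g)
      ≈⟨ solve 7 (λ K V q M x y z → K :* (V :* (x :+ y) :+ q :* (M :* M) :* z)
                   := (V :* K :* x :+ V :* K :* y) :+ K :* (q :* (M :* M)) :* z) refl K V q M f₁ f₂ g ⟩
    V * K * f₁ + V * K * f₂ + K * (q * (M * M)) * g
      ≈⟨ +-cong (+-cong (*-congʳ (^-homo-* q ν (k ℕ.* ν))) (*-congʳ (^-homo-* q ν (k ℕ.* ν)))) tail≈ ⟨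
    _ ∎
    where
    ν = suc μ
    K = q ^ (k ℕ.* ν)
    V = q ^ ν
    M = q ^ μ
    f = φ (suc a) (suc (suc b)) (suc d) ν
    f₁₂ = φ a (suc b) (suc d) ν
    f₁ = φ a (suc (suc b)) (suc (suc d)) ν
    f₂ = φ (suc a) (suc b) d ν
    g = φ a (suc b) (suc d) μ
    n = N (suc (suc k)) a (suc b) (suc d)

    -- On the left, the common q^(kν) and the q^(2μ+1) of `φ-interior`; on the right, q^(k+1) from
    -- the monomial and q^((k+2)μ) from the argument of `N`.
    exponents : k ℕ.* ν ℕ.+ suc (μ ℕ.+ μ) ≡ suc k ℕ.+ suc (suc k) ℕ.* μ
    exponents = ℕ-solve 2 (λ k μ →
      k :× (con₁ 1 :⊕ μ) :⊕ (con₁ 1 :⊕ (μ :⊕ μ)) :≡ (con₁ 1 :⊕ k) :⊕ (con₁ 2 :⊕ k) :× μ) ≡.refl k μ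
      where open +-*-Solver using () renaming (solve to ℕ-solve; _:+_ to _:⊕_; _:*_ to _:×_; _:=_ to _:≡_; con to con₁)

    tail≈ : (monomial (suc k) S.* n) ν ≈ K * (q * (M * M)) * g
    tail≈ = begin
      (monomial (suc k) S.* n) ν
        ≈⟨ monomial-suc (q ^ suc k) n μ ⟩
      q ^ suc k * (q ^ (suc (suc k) ℕ.* μ) * g)
        ≈⟨ *-assoc _ _ _ ⟨
      q ^ suc k * q ^ (suc (suc k) ℕ.* μ) * g
        ≈⟨ *-congʳ (^-homo-* q (suc k) (suc (suc k) ℕ.* μ)) ⟨
      q ^ (suc k ℕ.+ suc (suc k) ℕ.* μ) * g
        ≡⟨ ≡.cong (λ i → q ^ i * g) exponents ⟨
      q ^ (k ℕ.* ν ℕ.+ suc (μ ℕ.+ μ)) * g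
        ≈⟨ *-congʳ (trans (^-homo-* q (k ℕ.* ν) (suc (μ ℕ.+ μ))) (*-congˡ (*-congˡ (^-homo-* q μ μ)))) ⟩
      K * (q * (M * M)) * g ∎

-- Chains in the trapezoid.

module Trapezoid {c ℓ} (R : CommutativeRing c ℓ) (q : CommutativeRing.Carrier R) (inv : ℕ → CommutativeRing.Carrier R)
  (inverse : Inverses R q inv) (r m : ℕ) (1≤r : 1 ≤ r) (2r≤s : 2 ℕ.* r ≤ 2 ℕ.+ m) where
  open CommutativeRing R hiding (zero)
  open Ops rawRing using (_^_)

  private
    s = 2 ℕ.+ m
    P = trapezoid r s 1≤r 2r≤s
    T = series R
    module S where
      open Ops (Series rawRing) public
      open CommutativeRing T public
        using (sym; trans; reflexive; *-congˡ; *-congʳ; +-congˡ; +-monoid; *-identityʳ)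

  open Cell
  open FiniteGradedPoset P using (elements; complete; unique; _⊑?_; isDecPartialOrder)
  open Algebra.Properties.Semiring.Exp semiring using (^-homo-*)
  open ListSums R
  open NumeratorSeries R q inv inverse public
  open Elimination T

  private
    v : Cell r s → Carrier
    v y = q ^ ρ y

    w : List (Cell r s) → Carrier
    w ys = q ^ ℕ-sum (map ρ ys)

  open Quadrants R {Cell r s} row col elements using (point; rows-all)

  private
    point≈ : ∀ φ x → point φ (row x) (col x) ≈ φ x
    point≈ φ x = Σ-point (IsDecPartialOrder._≟_ isDecPartialOrder) φ unique (complete x)

  open QuadrantSeries R row col elements v point≈

  private
    isWeight : IsWeight R v w
    isWeight = record { w-[] = refl ; w-∷ = λ x l → ^-homo-* q (ρ x) (ℕ-sum (map ρ l)) }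

  open ChainSums R _⊑?_ elements v w isWeight

  chainSeries : S.Carrier
  chainSeries n = Σ[ w ] (filter (linked? _⊑?_) (tuples n elements))

  private
    -- The order on cells unfolds to the condition defining the quadrant at `(row x , col x)`, so
    -- the indicators on both sides coincide by computation.
    above≈F : ∀ n x → above n x ≈ F (row x) (col x) n
    above≈F zero    x = refl
    above≈F (suc n) x = Σ-cong (λ y → *-congˡ (*-congˡ (above≈F n y))) elements

    chainSeries≈F-rows : chainSeries S.≈ F-rows r
    chainSeries≈F-rows zero    = chains-zero
    chainSeries≈F-rows (suc n) = trans (chains-suc n)
      (trans (Σ-cong (λ y → *-congˡ (above≈F n y)) elements) (sym (rows-all _ r row≤r)))

  -- The shifted factorial (q^k t; q)_n. As the height is s - 2 = m, the full denominator is
  -- `E 0 (suc m)`.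
  E : ℕ → ℕ → S.Carrier
  E k n = S.∏< n (λ i → S.1# S.- monomial (k ℕ.+ i))

  private
    E-first : ∀ k n → E k (suc n) S.≈ (S.1# S.- monomial k) S.* E (suc k) n
    E-first k n = S.trans
      (S.*-congʳ {x = E′} (S.reflexive (≡.cong (λ i → S.1# S.- monomial i) (ℕₚ.+-identityʳ k))))
      (S.*-congˡ {x = S.1# S.- monomial k}
        (∏<-cong T n (λ i → S.reflexive (≡.cong (λ j → S.1# S.- monomial j) (ℕₚ.+-suc k i)))))
      where E′ = S.∏< n (λ i → S.1# S.- monomial (k ℕ.+ suc i))

    module _ {a e k : ℕ} (k+2+n≡s : k ℕ.+ (2 ℕ.+ (a ℕ.+ a ℕ.+ e)) ≡ s) (a<r : suc a ≤ r) where
      γ = suc (k ℕ.+ a)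

      -- This places the corner inside the trapezoid and, for e = 0, makes γ the last column of its
      -- row.
      γ+suca : γ ℕ.+ suc a ℕ.+ e ≡ s
      γ+suca = ≡.trans
        (solve 3 (λ a e k → con 1 :+ (k :+ a) :+ (con 1 :+ a) :+ e := k :+ (con 2 :+ (a :+ a :+ e))) ≡.refl a e k)
        k+2+n≡s
        where open +-*-Solver

      corner : Cell r s
      corner = cell (suc a) γ (s≤s z≤n) a<r (s≤s (ℕₚ.m≤n+m a k))
        (ℕₚ.m+n≤o⇒m≤o∸n γ (≡.subst (γ ℕ.+ suc a ≤_) γ+suca (ℕₚ.m≤m+n _ e)))

      v-corner : v corner ≡ q ^ k
      v-corner = ≡.cong (q ^_) (ℕₚ.m+n∸n≡m k a)

      interior : F (suc a) γ S.+ F a (suc γ) S.≈ (F a γ S.+ F (suc a) (suc γ)) S.+ (monomial k S.* F (suc a) γ)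
      interior = ≡.subst (λ z → F (suc a) γ S.+ F a (suc γ)
          S.≈ (F a γ S.+ F (suc a) (suc γ)) S.+ ((const rawRing z S.* var rawRing) S.* F (suc a) γ))
        v-corner (F-interior corner ≡.refl ≡.refl)

      boundary : e ≡ 0 → F (suc a) γ S.≈ F a γ S.+ (monomial k S.* F (suc a) γ)
      boundary ≡.refl = ≡.subst (λ z → F (suc a) γ S.≈ F a γ S.+ ((const rawRing z S.* var rawRing) S.* F (suc a) γ))
        v-corner (F-boundary corner ≡.refl ≡.refl col≤γ)
        where
        col≤γ : ∀ y → row y ≡ suc a → col y ≤ γ
        col≤γ y ρ≡ = ℕₚ.≤-trans (col≤ y) (ℕₚ.≤-reflexive (≡.trans (≡.cong (s ∸_) ρ≡)
          (≡.trans (≡.cong (_∸ suc a) (≡.sym (≡.trans (≡.sym (ℕₚ.+-identityʳ _)) γ+suca))) (ℕₚ.m+n∸n≡m γ (suc a)))))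

    -- The corner has rank k and distance e from the boundary row + col = s; the ranks k, …, k + n occur above it.
    F-numerator : ∀ a e k {γ n b} → γ ≡ suc (k ℕ.+ a) → n ≡ a ℕ.+ a ℕ.+ e → b ≡ a ℕ.+ e →
      k ℕ.+ (2 ℕ.+ n) ≡ s → suc a ≤ r → F (suc a) γ S.* E k (suc n) S.≈ N k a b e
    F-numerator zero zero k ≡.refl ≡.refl ≡.refl n≡ a<r =
      boundary-step {c = monomial k} {E = E k 1} (boundary n≡ a<r ≡.refl) (E-first k 0)
        (S.trans (S.*-identityʳ (F 0 (suc (k ℕ.+ 0)))) (S.trans (F-zero 1≤row (suc (k ℕ.+ 0))) (S.sym (N₀ k 0 0))))
    F-numerator zero (suc e) k ≡.refl ≡.refl ≡.refl n≡ a<r =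
      edge-step {c = monomial k} {E = E k (suc (suc e))} (interior n≡ a<r)
        (S.trans (F-zero 1≤row (suc (k ℕ.+ 0))) (S.sym (F-zero 1≤row (suc (suc (k ℕ.+ 0))))))
        (E-first k (suc e))
        (S.trans (F-numerator zero e (suc k) ≡.refl ≡.refl ≡.refl (≡.trans (≡.sym (ℕₚ.+-suc k (2 ℕ.+ e))) n≡) a<r)
                 (S.trans (N₀ (suc k) e e) (S.sym (N₀ k (suc e) (suc e)))))
    F-numerator (suc a) zero k {γ} {n} ≡.refl ≡.refl b≡ n≡ a<r =
      ≡.subst (λ b → F (suc (suc a)) γ S.* E k (suc n) S.≈ N k (suc a) b 0)
        (≡.sym (≡.trans b≡ (ℕₚ.+-identityʳ (suc a))))
      (boundary-step {c = monomial k} {E = E k (suc n)} (boundary n≡ a<r ≡.refl) (E-first k n)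
        (S.trans (F-numerator a 1 (suc k) (≡.cong suc (ℕₚ.+-suc k a))
                   (solve 1 (λ a → a :+ (con 1 :+ a) :+ con 0 := a :+ a :+ con 1) ≡.refl a)
                   (ℕₚ.+-comm 1 a) (≡.trans (≡.sym (ℕₚ.+-suc k _)) n≡) (ℕₚ.<⇒≤ a<r))
                 (S.sym (N-boundary k a))))
      where open +-*-Solver
    F-numerator (suc a) (suc e) k {γ} {n} ≡.refl ≡.refl b≡ n≡ a<r =
      ≡.subst (λ b → F (suc (suc a)) γ S.* E k (suc n) S.≈ N k (suc a) b (suc e))
        (≡.sym (≡.trans b≡ (≡.cong suc (ℕₚ.+-suc a e))))
      (interior-step {c = monomial k} {monomial (suc k)} {E = E k (suc n)} {E (suc k) n} {E (suc (suc k)) n′}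
        (interior n≡ a<r) (N-interior k a (a ℕ.+ e) e)
        (E-first k n) (E-first (suc k) n′)
        -- Dropping a row raises the distance `e` to the boundary by one, dropping a column lowers
        -- it by one, and doing both keeps it; the induction is lexicographic in `(a , e)`.
        (F-numerator a (suc (suc e)) (suc k) (≡.cong suc (ℕₚ.+-suc k a))
          (solve 2 (λ a e → a :+ (con 1 :+ a) :+ (con 1 :+ e) := a :+ a :+ (con 2 :+ e)) ≡.refl a e)
          (solve 2 (λ a e → con 2 :+ (a :+ e) := a :+ (con 2 :+ e)) ≡.refl a e)
          s₁ (ℕₚ.<⇒≤ a<r))
        (F-numerator (suc a) e (suc k) ≡.refl
          (solve 2 (λ a e → a :+ (con 1 :+ a) :+ (con 1 :+ e) := con 1 :+ (a :+ (con 1 :+ a)) :+ e) ≡.refl a e)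
          ≡.refl s₁ a<r)
        (≡.subst (λ i → F (suc a) (suc (suc (k ℕ.+ suc a))) S.* E (suc (suc k)) i
                       S.≈ N (suc (suc k)) a (suc (a ℕ.+ e)) (suc e))
          (≡.sym n′≡)
          (F-numerator a (suc e) (suc (suc k)) (≡.cong (λ i → suc (suc i)) (ℕₚ.+-suc k a)) ≡.refl
            (≡.sym (ℕₚ.+-suc a e)) s₂ (ℕₚ.<⇒≤ a<r))))
      where
      open +-*-Solver
      n′ = a ℕ.+ suc a ℕ.+ suc e
      n′≡ : n′ ≡ suc (a ℕ.+ a ℕ.+ suc e)
      n′≡ = ≡.cong (ℕ._+ suc e) (ℕₚ.+-suc a a)
      s₁ : suc k ℕ.+ (2 ℕ.+ n′) ≡ s
      s₁ = ≡.trans (≡.sym (ℕₚ.+-suc k _)) n≡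
      s₂ : suc (suc k) ℕ.+ (2 ℕ.+ (a ℕ.+ a ℕ.+ suc e)) ≡ s
      s₂ = ≡.trans (solve 2 (λ k i → con 2 :+ k :+ (con 2 :+ i) := con 1 :+ k :+ (con 2 :+ (con 1 :+ i))) ≡.refl k _)
             (≡.trans (≡.cong (λ i → suc k ℕ.+ (2 ℕ.+ i)) (≡.sym n′≡)) s₁)

  -- From 2r ≤ s: the truncated subtractions in b = m - α and d = b - α are exact.
  2α≤m : ∀ {α} → α < r → α ℕ.+ α ≤ m
  2α≤m {α} α<r = ℕ.s≤s⁻¹ (ℕ.s≤s⁻¹ (≡.subst (_≤ s) (solve 1 (λ α → con 2 :* (con 1 :+ α) := con 2 :+ (α :+ α)) ≡.refl α)
    (ℕₚ.≤-trans (ℕₚ.*-monoʳ-≤ 2 α<r) 2r≤s)))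
    where open +-*-Solver

  m∸α≡ : ∀ {α} → α < r → m ∸ α ≡ α ℕ.+ (m ∸ α ∸ α)
  m∸α≡ {α} α<r = ≡.sym (ℕₚ.m+[n∸m]≡n (ℕₚ.m+n≤o⇒m≤o∸n α (2α≤m α<r)))

  summand : ℕ → S.Carrier
  summand j = N 0 (suc j) b d S.+ (monomial 0 S.- S.1#) S.* N 1 j b (suc d)
    where
    b = m ∸ suc j
    d = b ∸ suc j

  private
    -- The leading 1 of the formula is row 1, a chain with one cell of each rank 0, ..., m. Every
    -- further row contributes one summand.
    rows-numerator : ∀ k → suc k ≤ r → F-rows (suc k) S.* E 0 (suc m) S.≈ S.1# S.+ S.∑< k summand
    rows-numerator zero 1≤r = S.trans
      (S.*-congʳ {x = E 0 (suc m)} {x = F-rows 1} {F 1 1} first)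
      (S.trans (F-numerator 0 m 0 ≡.refl ≡.refl ≡.refl ≡.refl 1≤r)
               (S.trans (N₀ 0 m m) (λ n → sym (+-identityʳ _))))
      where
      first : F-rows 1 S.≈ F 1 1
      first = cancel (S.trans (F-zero 1≤row 1) (S.sym (F-rows-zero 1≤row))) (F-rows-suc row≤col 0)
        where
        cancel : ∀ {x y z w : S.Carrier} → y S.≈ z → x S.+ y S.≈ z S.+ w → x S.≈ w
        cancel {x} {y} {z} {w} y≈z e n = ∙-cancelʳ (y n) (x n) (w n)
          (trans (e n) (trans (+-comm _ _) (+-congˡ (sym (y≈z n)))))
          where open import Algebra.Properties.Group +-group using (∙-cancelʳ)
    rows-numerator (suc j) α<r = S.trans
      (row-step {b = F-rows α} {x₊ = F (suc α) (suc α)} {x₋ = F α (suc α)}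
                {c = monomial 0} {E = E 0 (suc m)} {E 1 m}
        (F-rows-suc row≤col α)
        (rows-numerator j (ℕₚ.<⇒≤ α<r))
        -- The corner `(suc α , suc α)` has rank 0 and a = α; the corner `(α , suc α)` of the
        -- overlap, used below, has rank 1 and a = j. Both lie in column `suc α`, hence share b = m
        -- - α.
        (F-numerator α d 0 ≡.refl m≡ b≡ ≡.refl α<r)
        (E-first 0 m)
        (≡.subst (λ i → F α (suc α) S.* E 1 i S.≈ N 1 j b (suc d)) (≡.sym m≡suc)
          (F-numerator j (suc d) 1 ≡.refl ≡.refl (≡.trans b≡ (≡.sym (ℕₚ.+-suc j d)))
            (≡.cong (2 ℕ.+_) (≡.sym m≡suc)) (ℕₚ.<⇒≤ α<r))))
      (S.trans (λ n → +-assoc _ _ _)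
        (S.+-congˡ {x = S.1#} (S.sym (sum-last S.+-monoid j summand))))
      where
      α = suc j
      b = m ∸ α
      d = b ∸ α
      b≡ = m∸α≡ α<r
      m≡ : m ≡ α ℕ.+ α ℕ.+ d
      m≡ = ≡.trans (≡.sym (ℕₚ.m+[n∸m]≡n (ℕₚ.m+n≤o⇒m≤o α (2α≤m α<r))))
        (≡.trans (≡.cong (α ℕ.+_) b≡) (≡.sym (ℕₚ.+-assoc α α d)))
      m≡suc : m ≡ suc (j ℕ.+ j ℕ.+ suc d)
      m≡suc = ≡.trans m≡
        (solve 2 (λ j d → (con 1 :+ j) :+ (con 1 :+ j) :+ d := con 1 :+ (j :+ j :+ (con 1 :+ d))) ≡.refl j d)
        where open +-*-Solver

  chainSeries-numerator : chainSeries S.* E 0 (suc m) S.≈ S.1# S.+ S.∑< (r ∸ 1) summand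
  chainSeries-numerator = S.trans
    (S.*-congʳ {x = E 0 (suc m)} (S.trans chainSeries≈F-rows (S.reflexive (≡.cong F-rows (≡.sym r≡)))))
    (rows-numerator (r ∸ 1) (ℕₚ.≤-reflexive r≡))
    where
    r≡ : suc (r ∸ 1) ≡ r
    r≡ = ℕₚ.m+[n∸m]≡n 1≤r

-- The concrete rings and the inverses of 1 - q^u.

ℤ⟦q⟧-ring : CommutativeRing _ _
ℤ⟦q⟧-ring = series ℤₚ.+-*-commutativeRing

ℤ⟦q⟧⟦t⟧-ring : CommutativeRing _ _
ℤ⟦q⟧⟦t⟧-ring = series ℤ⟦q⟧-ring

private
  module QR = CommutativeRing ℤ⟦q⟧-ring
  module TR = CommutativeRing ℤ⟦q⟧⟦t⟧-ring
  module QS = SeriesProperties ℤₚ.+-*-commutativeRing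
  module TS = SeriesProperties ℤ⟦q⟧-ring

q^-low : ∀ u f {k} → k < u → (q Q.^ u Q.* f) k ≡ + 0
q^-low (suc u) f {zero}  _         = ≡.trans (QR.*-assoc q (q Q.^ u) f 0) (QS.var-*-zero (q Q.^ u Q.* f))
q^-low (suc u) f {suc k} (s≤s k<u) =
  ≡.trans (QR.*-assoc q (q Q.^ u) f (suc k)) (≡.trans (QS.var-*-suc (q Q.^ u Q.* f) k) (q^-low u f k<u))

q^-high : ∀ u f k → (q Q.^ u Q.* f) (u ℕ.+ k) ≡ f k
q^-high zero    f k = QR.*-identityˡ f k
q^-high (suc u) f k =
  ≡.trans (QR.*-assoc q (q Q.^ u) f (suc (u ℕ.+ k))) (≡.trans (QS.var-*-suc (q Q.^ u Q.* f) (u ℕ.+ k)) (q^-high u f k))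

-- The coefficients of the inverse have period u = j + 1, so from degree u on the copy shifted by
-- q^u cancels them. Below u, only 0 is divisible by u.
geometric : ∀ j → (Q.1# Q.- q Q.^ suc j) Q.* 1/[1-q^ suc j ] Q.≈ Q.1#
geometric j n = ≡.trans (expand n) (value n)
  where
  u = suc j
  g = 1/[1-q^ u ]

  expand : (Q.1# Q.- q Q.^ u) Q.* g Q.≈ g Q.- q Q.^ u Q.* g
  expand = solve 2 (λ x g → (con (+ 1) :- x) :* g := g :- x :* g) QR.refl (q Q.^ u) g
    where open IntegerSolver ℤ⟦q⟧-ring

  g-∣ : ∀ {k} → u ∣ k → g k ≡ + 1
  g-∣ {k} u∣k = ≡.cong (if_then + 1 else + 0) (dec-true (u ∣? k) u∣k)

  g-∤ : ∀ {k} → ¬ u ∣ k → g k ≡ + 0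
  g-∤ {k} u∤k = ≡.cong (if_then + 1 else + 0) (dec-false (u ∣? k) u∤k)

  periodic : ∀ k → g (u ℕ.+ k) ≡ g k
  periodic k with u ∣? k
  ... | yes u∣k = ≡.trans (g-∣ (∣m∣n⇒∣m+n ∣-refl u∣k)) (≡.sym (g-∣ u∣k))
  ... | no u∤k  = ≡.trans (g-∤ (λ u∣u+k → u∤k (∣m+n∣m⇒∣n u∣u+k ∣-refl))) (≡.sym (g-∤ u∤k))

  low : ∀ n → n < u → g n ≡ Q.1# n
  low zero    _   = g-∣ (u ∣0)
  low (suc n) n<u = g-∤ (λ u∣n → ℕₚ.<⇒≱ n<u (∣⇒≤ u∣n))

  value : ∀ n → (g Q.- q Q.^ u Q.* g) n ≡ Q.1# n
  value n with ℕₚ.<-≤-connex n u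
  ... | inj₁ n<u = ≡.trans (≡.cong₂ (λ x y → x ℤ.+ ℤ.- y) (low n n<u) (q^-low u g n<u)) (ℤₚ.+-identityʳ _)
  ... | inj₂ u≤n with n ∸ u | ℕₚ.m+[n∸m]≡n u≤n
  ...   | k | ≡.refl = ≡.trans (≡.cong₂ (λ x y → x ℤ.+ ℤ.- y) (periodic k) (q^-high u g k)) (ℤₚ.+-inverseʳ (g k))

open QBinomials ℤ⟦q⟧-ring q (λ j → 1/[1-q^ suc j ]) geometric

-- Finiteness in q and polynomiality in q and t.

Finite : Q.Carrier → Set
Finite f = ∃ λ D → ∀ k → D ≤ k → f k ≡ + 0

finite-≈ : ∀ {f g} → f Q.≈ g → Finite f → Finite g
finite-≈ f≈g (D , z) = D , λ k D≤k → ≡.trans (≡.sym (f≈g k)) (z k D≤k)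

finite-0 : Finite Q.0#
finite-0 = 0 , λ _ _ → ≡.refl

finite-1 : Finite Q.1#
finite-1 = 1 , λ { (suc k) _ → ≡.refl }

finite-+ : ∀ {f g} → Finite f → Finite g → Finite (f Q.+ g)
finite-+ (D , z) (D′ , z′) = D ⊔ D′ , λ k D≤k →
  ≡.cong₂ ℤ._+_ (z k (ℕₚ.m⊔n≤o⇒m≤o D D′ D≤k)) (z′ k (ℕₚ.m⊔n≤o⇒n≤o D D′ D≤k))

finite-neg : ∀ {f} → Finite f → Finite (Q.- f)
finite-neg (D , z) = D , λ k D≤k → ≡.cong ℤ.-_ (z k D≤k)

finite-* : ∀ {f g} → Finite f → Finite g → Finite (f Q.* g)
finite-* {f} {g} (D , z) (D′ , z′) = D ℕ.+ D′ , go D f z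
  where
  go : ∀ D f → (∀ k → D ≤ k → f k ≡ + 0) → ∀ k → D ℕ.+ D′ ≤ k → (f Q.* g) k ≡ + 0
  go zero    f z k       _         = ≡.trans (QR.*-congʳ {x = g} {x = f} {Q.0#} (λ i → z i z≤n) k) (QR.zeroˡ g k)
  go (suc D) f z (suc k) (s≤s D≤k) = ≡.cong₂ ℤ._+_
    (≡.trans (≡.cong (f 0 ℤ.*_) (z′ (suc k) (ℕₚ.m≤n⇒m≤1+n (ℕₚ.m+n≤o⇒n≤o D D≤k)))) (ℤₚ.*-zeroʳ (f 0)))
    (go D (λ i → f (suc i)) (λ i D≤i → z (suc i) (s≤s D≤i)) k D≤k)

finite-q^ : ∀ n → Finite (q Q.^ n)
finite-q^ zero    = finite-1
finite-q^ (suc n) = finite-* {q} (2 , λ { (suc (suc k)) _ → ≡.refl ; (suc zero) (s≤s ()) }) (finite-q^ n)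

-- The defining product contains infinite geometric series, so finiteness is invisible there; the
-- q-Pascal recursion makes it an induction.
finite-binom : ∀ n k → Finite (binom n k)
finite-binom n       zero    = finite-1
finite-binom zero    (suc k) = finite-0
finite-binom (suc n) (suc k) = finite-≈ (QR.sym (pascal n k))
  (finite-+ (finite-* (finite-q^ (suc k)) (finite-binom n (suc k))) (finite-binom n k))

finite-binom⁻ : ∀ n k → Finite (binom⁻ n k)
finite-binom⁻ n zero    = finite-0
finite-binom⁻ n (suc k) = finite-binom n k

finite-φ : ∀ a b d ν → Finite (φ a b d ν)
finite-φ a b d ν = finite-* (finite-q^ (ν ℕ.* ν))
  (finite-+ (finite-* (finite-binom a ν) (finite-binom b ν))
            (finite-neg (finite-* (finite-* (finite-q^ d) (finite-binom (suc a) (suc ν))) (finite-binom⁻ (b ∸ 1) ν))))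

-- Each of the two products contains a binomial whose lower index exceeds the upper one: ν over a,
-- and ν + 1 over a + 1.
φ-degree : ∀ a b d {ν} → a < ν → φ a b d ν Q.≈ Q.0#
φ-degree a b d {ν} a<ν = begin
  φ a b d ν
    ≈⟨ QR.*-congˡ {x = q Q.^ (ν ℕ.* ν)} (QR.+-cong
         (QR.*-congʳ {x = binom b ν} (binom-> {a} {ν} a<ν))
         (QR.-‿cong (QR.*-congʳ {x = binom⁻ (b ∸ 1) ν} (QR.*-congˡ {x = q Q.^ d} (binom-> {suc a} {suc ν} (s≤s a<ν)))))) ⟩
  q Q.^ (ν ℕ.* ν) Q.* (Q.0# Q.* binom b ν Q.- q Q.^ d Q.* Q.0# Q.* binom⁻ (b ∸ 1) ν)
    ≈⟨ solve 4 (λ x y z w → x :* (con (+ 0) :* y :- z :* con (+ 0) :* w) := con (+ 0)) QR.refl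
         (q Q.^ (ν ℕ.* ν)) (binom b ν) (q Q.^ d) (binom⁻ (b ∸ 1) ν) ⟩
  Q.0# ∎
  where
  open IntegerSolver ℤ⟦q⟧-ring
  open Relation.Binary.Reasoning.Setoid QR.setoid

polynomial-≈ : ∀ {f g} → f T.≈ g → IsPolynomial f → IsPolynomial g
polynomial-≈ f≈g (D , z) = D , λ n k D≤ → ≡.trans (≡.sym (f≈g n k)) (z n k D≤)

polynomial-+ : ∀ {f g} → IsPolynomial f → IsPolynomial g → IsPolynomial (f T.+ g)
polynomial-+ (D , z) (D′ , z′) = D ⊔ D′ , λ
  { n k (inj₁ D≤n) → ≡.cong₂ ℤ._+_ (z n k (inj₁ (ℕₚ.m⊔n≤o⇒m≤o D D′ D≤n))) (z′ n k (inj₁ (ℕₚ.m⊔n≤o⇒n≤o D D′ D≤n)))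
  ; n k (inj₂ D≤k) → ≡.cong₂ ℤ._+_ (z n k (inj₂ (ℕₚ.m⊔n≤o⇒m≤o D D′ D≤k))) (z′ n k (inj₂ (ℕₚ.m⊔n≤o⇒n≤o D D′ D≤k))) }

polynomial-neg : ∀ {f} → IsPolynomial f → IsPolynomial (T.- f)
polynomial-neg (D , z) = D , λ n k D≤ → ≡.cong ℤ.-_ (z n k D≤)

polynomial-0 : IsPolynomial T.0#
polynomial-0 = 0 , λ _ _ _ → ≡.refl

polynomial-1 : IsPolynomial T.1#
polynomial-1 = 1 , λ
  { zero    (suc k) (inj₂ _) → ≡.refl
  ; (suc n) k       _        → ≡.refl }

polynomial-t* : ∀ {f} → IsPolynomial f → IsPolynomial (t T.* f)
polynomial-t* {f} (D , z) = suc D , λ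
  { zero    k (inj₂ _)         → TS.var-*-zero f k
  ; (suc n) k (inj₁ (s≤s D≤n)) → ≡.trans (TS.var-*-suc f n k) (z n k (inj₁ D≤n))
  ; (suc n) k (inj₂ D<k)       → ≡.trans (TS.var-*-suc f n k) (z n k (inj₂ (ℕₚ.<⇒≤ D<k))) }

-- Multiplication by t is a shift, so this form suits both the degree bounds and the extraction of
-- coefficients.
[t-1]* : ∀ f → (t T.- T.1#) T.* f T.≈ t T.* f T.- f
[t-1]* f = solve 2 (λ x f → (x :- con (+ 1)) :* f := x :* f :- f) TR.refl t f
  where open IntegerSolver ℤ⟦q⟧⟦t⟧-ring

-- One bound has to serve both exponents. Only the coefficients below `B` can be nonzero, and their
-- finitely many bounds in q have a maximum.
polynomial-coefficients : ∀ {f} B → (∀ n → Finite (f n)) → (∀ n → B ≤ n → f n Q.≈ Q.0#) → IsPolynomial f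
polynomial-coefficients {f} B fin z = B ⊔ proj₁ (bound B) , λ
  { n k (inj₁ D≤n) → z n (ℕₚ.m⊔n≤o⇒m≤o B _ D≤n) k
  ; n k (inj₂ D≤k) → low n k (ℕₚ.m⊔n≤o⇒n≤o B _ D≤k) }
  where
  bound : ∀ B → ∃ λ D → ∀ n k → n < B → D ≤ k → f n k ≡ + 0
  bound zero    = 0 , λ _ _ ()
  bound (suc B) with bound B | fin B
  ... | D , w | D′ , w′ = D ⊔ D′ , λ n k n<B D≤k → case (ℕₚ.m≤n⇒m<n∨m≡n (ℕ.s≤s⁻¹ n<B)) D≤k
    where
    case : ∀ {n k} → n < B ⊎ n ≡ B → D ⊔ D′ ≤ k → f n k ≡ + 0
    case (inj₁ n<B)    D≤k = w _ _ n<B (ℕₚ.m⊔n≤o⇒m≤o D D′ D≤k)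
    case (inj₂ ≡.refl) D≤k = w′ _ (ℕₚ.m⊔n≤o⇒n≤o D D′ D≤k)

  low : ∀ n k → proj₁ (bound B) ≤ k → f n k ≡ + 0
  low n k D≤k with ℕₚ.<-≤-connex n B
  ... | inj₁ n<B = proj₂ (bound B) n k n<B D≤k
  ... | inj₂ B≤n = z n B≤n k

polynomial-∑ : ∀ n {f : ℕ → T.Carrier} → (∀ i → IsPolynomial (f i)) → IsPolynomial (T.∑< n f)
polynomial-∑ zero    p = polynomial-0
polynomial-∑ (suc n) p = polynomial-+ (p 0) (polynomial-∑ n (λ i → p (suc i)))

-- Comparison with the defining formulas, and explicit coefficients.

-- For b = a + d the integer arguments b - d + 1 and a + d - 1 are a + 1 and b - 1; the bound 1 ≤ b
-- makes the integer b - 1 agree with the truncated one.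
Φ-coeff≡φ : ∀ a b d ν → b ≡ a ℕ.+ d → 1 ≤ b → Φ-coeff a b d ν ≡ φ a b d ν
Φ-coeff≡φ a b d ν b≡a+d 1≤b = ≡.cong₂
  (λ x y → q Q.^ (ν ℕ.* ν) Q.* (binom a ν Q.* binom b ν Q.- q Q.^ d Q.* x Q.* y))
  (≡.cong₂ gauss upper (≡.cong +_ (ℕₚ.+-comm ν 1))) (lower ν)
  where
  upper : + b ℤ.- + d ℤ.+ + 1 ≡ + suc a
  upper = ≡.trans (≡.cong (ℤ._+ + 1) (≡.trans (ℤₚ.m-n≡m⊖n b d)
            (≡.trans (≡.cong (_⊖ d) b≡a+d) (≡.trans (ℤₚ.⊖-≥ (ℕₚ.m≤n+m d a)) (≡.cong +_ (ℕₚ.m+n∸n≡m a d))))))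
          (≡.cong +_ (ℕₚ.+-comm a 1))

  b-1 : + a ℤ.+ + d ℤ.- + 1 ≡ + (b ∸ 1)
  b-1 = ≡.trans (≡.cong (λ x → + x ℤ.- + 1) (≡.sym b≡a+d)) (≡.trans (ℤₚ.m-n≡m⊖n b 1) (ℤₚ.⊖-≥ 1≤b))

  lower : ∀ ν → gauss (+ a ℤ.+ + d ℤ.- + 1) (+ ν ℤ.- + 1) ≡ binom⁻ (b ∸ 1) ν
  lower zero    = ≡.cong (λ x → gauss x -[1+ 0 ]) b-1
  lower (suc ν) = ≡.cong (λ x → gauss x (+ ν)) b-1

∑<-coefficient : ∀ k (f : ℕ → T.Carrier) n → T.∑< k f n Q.≈ Q.∑< k (λ j → f j n)
∑<-coefficient zero    f n = QR.refl
∑<-coefficient (suc k) f n = QR.+-congˡ {x = f 0 n} (∑<-coefficient k (λ j → f (suc j)) n)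

𝒢≈𝒢-coeff : ∀ a b n → 𝒢 a b n Q.≈ 𝒢-coeff a b n
𝒢≈𝒢-coeff a b zero = QR.+-congˡ {x = Φ-coeff a b (b ∸ a) 0} (begin
  ((t T.- T.1#) T.* g) 0           ≈⟨ [t-1]* g 0 ⟩
  (t T.* g) 0 Q.- g 0
    ≈⟨ QR.+-cong (TS.var-*-zero g) (QR.-‿cong (QR.*-identityˡ (Φ-coeff (a ∸ 1) b (suc (b ∸ a)) 0))) ⟩
  Q.0# Q.- Φ-coeff (a ∸ 1) b (suc (b ∸ a)) 0  ≈⟨ QR.+-identityˡ _ ⟩
  Q.- Φ-coeff (a ∸ 1) b (suc (b ∸ a)) 0       ∎)
  where
  open Relation.Binary.Reasoning.Setoid QR.setoid
  g = rescale ℤ⟦q⟧ q (Φ (a ∸ 1) b (suc (b ∸ a)))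
𝒢≈𝒢-coeff a b (suc n) = begin
  x Q.+ ((t T.- T.1#) T.* g) (suc n)          ≈⟨ QR.+-congˡ {x = x} ([t-1]* g (suc n)) ⟩
  x Q.+ ((t T.* g) (suc n) Q.- g (suc n))
    ≈⟨ QR.+-congˡ {x = x} (QR.+-congʳ {x = Q.- g (suc n)} (TS.var-*-suc g n)) ⟩
  x Q.+ (g n Q.- g (suc n))                   ≈⟨ QR.+-assoc x (g n) (Q.- g (suc n)) ⟨
  x Q.+ g n Q.- g (suc n)                     ∎
  where
  open Relation.Binary.Reasoning.Setoid QR.setoid
  g = rescale ℤ⟦q⟧ q (Φ (a ∸ 1) b (suc (b ∸ a)))
  x = Φ-coeff a b (b ∸ a) (suc n)

formula≈formula-coeff : ∀ r s n → formula r s n Q.≈ formula-coeff r s n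
formula≈formula-coeff r s n = go n
  where
  sums : ∀ n → T.∑< (r ∸ 1) (λ j → 𝒢 (suc j) (s ∸ 2 ∸ suc j)) n
                 Q.≈ Q.∑< (r ∸ 1) (λ j → 𝒢-coeff (suc j) (s ∸ 2 ∸ suc j) n)
  sums n = QR.trans (∑<-coefficient (r ∸ 1) (λ j → 𝒢 (suc j) (s ∸ 2 ∸ suc j)) n)
             (sum-cong-≋ {r ∸ 1} (λ i → 𝒢≈𝒢-coeff (suc (toℕ i)) (s ∸ 2 ∸ suc (toℕ i)) n))
    where open import Algebra.Properties.Monoid.Sum QR.+-monoid
  go : ∀ n → formula r s n Q.≈ formula-coeff r s n
  go zero    = QR.+-congˡ {x = Q.1#} (sums 0)
  go (suc n) = QR.+-congˡ {x = Q.0#} (sums (suc n))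

-- The numerator of the trapezoid.

module _ (r m : ℕ) (1≤r : 1 ≤ r) (2r≤s : 2 ℕ.* r ≤ 2 ℕ.+ m) where
  private
    s = 2 ℕ.+ m
    P = trapezoid r s 1≤r 2r≤s
  open Trapezoid ℤ⟦q⟧-ring q (λ j → 1/[1-q^ suc j ]) geometric r m 1≤r 2r≤s

  private
    monomial-0 : monomial 0 T.≈ t
    monomial-0 = TR.trans (TR.*-congʳ {x = t} (TR.sym TS.const-1#)) (TR.*-identityˡ t)

    [t-1]N : ∀ j → (monomial 0 T.- T.1#) T.* N 1 j (m ∸ suc j) (suc (m ∸ suc j ∸ suc j))
                   T.≈ (t T.- T.1#) T.* N 1 j (m ∸ suc j) (suc (m ∸ suc j ∸ suc j))
    [t-1]N j = TR.*-congʳ {x = N 1 j (m ∸ suc j) (suc (m ∸ suc j ∸ suc j))} (TR.+-congʳ {x = T.- T.1#} monomial-0)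

    N-polynomial : ∀ k a b d → IsPolynomial (N k a b d)
    N-polynomial k a b d = polynomial-coefficients (suc a)
      (λ ν → finite-* (finite-q^ (k ℕ.* ν)) (finite-φ a b d ν))
      (λ ν a<ν → QR.trans (QR.*-congˡ {x = q Q.^ (k ℕ.* ν)} (φ-degree a b d a<ν)) (QR.zeroʳ (q Q.^ (k ℕ.* ν))))

    summand-polynomial : ∀ j → IsPolynomial (summand j)
    summand-polynomial j = polynomial-+ (N-polynomial 0 (suc j) (m ∸ suc j) (m ∸ suc j ∸ suc j))
      (polynomial-≈ (TR.sym (TR.trans ([t-1]N j) ([t-1]* n))) (polynomial-+ (polynomial-t* p) (polynomial-neg p)))
      where
      n = N 1 j (m ∸ suc j) (suc (m ∸ suc j ∸ suc j))
      p = N-polynomial 1 j (m ∸ suc j) (suc (m ∸ suc j ∸ suc j))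

    𝒢≈summand : ∀ j → suc j < r → 𝒢 (suc j) (m ∸ suc j) T.≈ summand j
    𝒢≈summand j α<r = TR.+-cong
      (λ ν → QR.trans (QR.reflexive (Φ-coeff≡φ α b d ν b≡ 1≤b)) (QR.sym (QR.*-identityˡ (φ α b d ν))))
      (TR.trans (TR.*-congˡ {x = t T.- T.1#} rescaled) (TR.sym ([t-1]N j)))
      where
      α = suc j
      b = m ∸ α
      d = b ∸ α
      b≡ : b ≡ α ℕ.+ d
      b≡ = m∸α≡ α<r
      1≤b : 1 ≤ b
      1≤b = ≡.subst (1 ≤_) (≡.sym b≡) (s≤s z≤n)
      rescaled : rescale ℤ⟦q⟧ q (Φ j b (suc d)) T.≈ N 1 j b (suc d)
      rescaled ν = QR.*-cong (QR.reflexive (≡.cong (q Q.^_) (≡.sym (ℕₚ.*-identityˡ ν))))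
        (QR.reflexive (Φ-coeff≡φ j b (suc d) ν (≡.trans b≡ (≡.sym (ℕₚ.+-suc j d))) 1≤b))

    formula≈ : formula r s T.≈ T.1# T.+ T.∑< (r ∸ 1) summand
    formula≈ = TR.+-congˡ {x = T.1#} (sum-cong-≋ {r ∸ 1} (λ i → 𝒢≈summand (toℕ i) (j<r i)))
      where
      open import Algebra.Properties.Monoid.Sum TR.+-monoid
      j<r : ∀ (i : Fin (r ∸ 1)) → suc (toℕ i) < r
      j<r i = ≡.subst (suc (suc (toℕ i)) ≤_) (ℕₚ.m+[n∸m]≡n 1≤r) (s≤s (toℕ<n i))

  formula-polynomial : IsPolynomial (formula r s)
  formula-polynomial = polynomial-≈ (TR.sym formula≈) (polynomial-+ polynomial-1 (polynomial-∑ (r ∸ 1) summand-polynomial))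

  formula-equation : A P T.* denominator P T.≈ formula r s
  formula-equation = TR.trans chainSeries-numerator (TR.sym formula≈)

open import Data.Nat using (_*_)

theorem4p2 : (r s : ℕ) (1≤r : 1 ≤ r) (2r≤s : 2 * r ≤ s) →
    (∀ h → IsNumerator (trapezoid r s 1≤r 2r≤s) h ⇔ h T.≈ formula r s)
    × (∀ h → IsNumerator (trapezoid r s 1≤r 2r≤s) h → ∀ n → h n Q.≈ formula-coeff r s n)
-- Since 2 ≤ 2r ≤ s, the cases s = 0 and s = 1 are void and s = 2 + m.
theorem4p2 r zero 1≤r 2r≤s = ⊥-elim (ℕₚ.1+n≰n (ℕₚ.≤-trans (ℕₚ.≤-trans (s≤s z≤n) (ℕₚ.*-monoʳ-≤ 2 1≤r)) 2r≤s))
theorem4p2 r (suc zero) 1≤r 2r≤s = ⊥-elim (ℕₚ.1+n≰n (ℕₚ.≤-trans (ℕₚ.*-monoʳ-≤ 2 1≤r) 2r≤s))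
theorem4p2 r s@(suc (suc m)) 1≤r 2r≤s = (λ h → mk⇔ (only h) (numerator h))
  , λ h isN n → QR.trans (only h isN n) (formula≈formula-coeff r s n)
  where
  P = trapezoid r s 1≤r 2r≤s

  only : ∀ h → IsNumerator P h → h T.≈ formula r s
  -- The cleared equation gives `h` outright as `A` times the denominator, so uniqueness is
  -- transitivity.
  only h isN = TR.trans (TR.sym (IsNumerator.equation isN)) (formula-equation r m 1≤r 2r≤s)

  numerator : ∀ h → h T.≈ formula r s → IsNumerator P h
  numerator h h≈ = record
    { polynomial = polynomial-≈ (TR.sym h≈) (formula-polynomial r m 1≤r 2r≤s)
    ; equation   = TR.trans (formula-equation r m 1≤r 2r≤s) (TR.sym h≈)
    }
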